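{- Let $n\ge 1$ be an integer and let $x,y$ be complex numbers such that no denominator below vanishes, i.e. $x\notin\{ -1,\dots,-n\}$, $x-y\notin\{ -1,\dots,-n\}$ and $y\notin\{ -n,-n+1,\dots,n-1\}$. Then $$\sum_{k=0}^n(-1)^k\binom{n}{k}\frac{\binom{y+k}{k}}{\binom{y-n+k}{k}}\frac{y}{y+k}H_{k}^{\langle3\rangle}(x)=\frac{(-1)^n}{2n}\,\frac{\binom{x-y+n}{n}}{\binom{x+n}{n}\binom{y}{n}}\Big\{\big[H_{n}^{\langle2\rangle}(x-y)-H_{n}^{\langle2\rangle}(x)\big]-\big[H_{n}(x-y)-H_{n}(x)\big]^2\Big\}.$$
   Context: For a complex number $u$ and an integer $k\ge 0$, $\binom{u}{k}=\frac{u(u-1)\cdots(u-k+1)}{k!}$ (equal to $1$ for $k=0$). For a complex number $u$ and a positive integer $\ell$, the generalized harmonic numbers of $\ell$-order are $H_0^{\langle\ell\rangle}(u)=0$ and $H_n^{\langle\ell\rangle}(u)=\sum_{k=1}^n\frac{1}{(u+k)^\ell}$ for $n\ge1$; $H_n(u)=H_n^{\langle1\rangle}(u)$. -}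

module Defs where

open import Algebra.Apartness.Bundles using (HeytingCommutativeRing; HeytingField)
open import Algebra.Bundles using (CommutativeRing; Semiring)
open import Data.Empty using (⊥-elim)
open import Data.Fin.Base using (Fin; zero; suc; toℕ)
import Data.Fin.Properties as Fin
open import Data.Integer.Base as ℤ using (ℤ; +_; -[1+_]; -1ℤ; 1ℤ)
open import Data.Nat.Base as ℕ using (ℕ; zero; suc; z≤n; s≤s; _!)
import Data.Integer.Properties as ℤ
import Data.Nat.Properties as ℕ
open import Data.Product.Base using (∃; ∃-syntax; _×_; _,_; proj₁; proj₂)
open import Data.Rational.Base as ℚ using (ℚ; 0ℚ; 1ℚ; ½; ∣_∣; positive; nonNegative; ≢-nonZero)
import Data.Rational.Properties as ℚ
open import Data.Rational.Solver using (module +-*-Solver)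
open import Data.Sum.Base as Sum using (_⊎_; inj₁; inj₂; [_,_]′)
open import Level using (0ℓ)
open import Relation.Binary.PropositionalEquality
  using (_≡_; _≢_; refl; sym; trans; cong; cong₂; subst; module ≡-Reasoning)
open import Relation.Nullary using (¬_; yes; no)

------------------------------------------------------------------------
-- Real numbers: Cauchy sequences of rationals

module Real where

  open +-*-Solver

  private
    sub-telescope : ∀ a b c → a ℚ.- c ≡ (a ℚ.- b) ℚ.+ (b ℚ.- c)
    sub-telescope = solve 3 (λ a b c → a :- c := (a :- b) :+ (b :- c)) refl

    sub-flip : ∀ a b → a ℚ.- b ≡ ℚ.- (b ℚ.- a)
    sub-flip = solve 2 (λ a b → a :- b := :- (b :- a)) refl

    sub-neg : ∀ a b → b ℚ.- a ≡ (ℚ.- a) ℚ.- (ℚ.- b)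
    sub-neg = solve 2 (λ a b → b :- a := (:- a) :- (:- b)) refl

    sub-+ : ∀ a b c d → (a ℚ.+ b) ℚ.- (c ℚ.+ d) ≡ (a ℚ.- c) ℚ.+ (b ℚ.- d)
    sub-+ = solve 4 (λ a b c d → (a :+ b) :- (c :+ d) := (a :- c) :+ (b :- d)) refl

    sub-* : ∀ a b c d → a ℚ.* b ℚ.- c ℚ.* d ≡ a ℚ.* (b ℚ.- d) ℚ.+ (a ℚ.- c) ℚ.* d
    sub-* = solve 4 (λ a b c d → a :* b :- c :* d := a :* (b :- d) :+ (a :- c) :* d) refl

    add-sub : ∀ a b → a ≡ (a ℚ.+ b) ℚ.- b
    add-sub = solve 2 (λ a b → a := (a :+ b) :- b) refl

    collect : ∀ b c e → b ℚ.* e ℚ.+ e ℚ.* c ≡ (b ℚ.+ c) ℚ.* e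
    collect = solve 3 (λ b c e → b :* e :+ e :* c := (b :+ c) :* e) refl

    regroup₁ : ∀ d a → d ℚ.+ (a ℚ.+ d) ≡ a ℚ.+ (d ℚ.+ d)
    regroup₁ = solve 2 (λ d a → d :+ (a :+ d) := a :+ (d :+ d)) refl

    regroup₂ : ∀ d e → (d ℚ.+ (e ℚ.+ d)) ℚ.+ (d ℚ.+ d) ≡ e ℚ.+ ((d ℚ.+ d) ℚ.+ (d ℚ.+ d))
    regroup₂ = solve 2 (λ d e → (d :+ (e :+ d)) :+ (d :+ d) := e :+ ((d :+ d) :+ (d :+ d))) refl

    sub-cross : ∀ a b c d → a ℚ.* (b ℚ.* d) ℚ.- b ℚ.* (a ℚ.* c) ≡ (a ℚ.* b) ℚ.* (d ℚ.- c)
    sub-cross = solve 4 (λ a b c d → a :* (b :* d) :- b :* (a :* c) := (a :* b) :* (d :- c)) refl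

    dist-sym : ∀ p q → ∣ p ℚ.- q ∣ ≡ ∣ q ℚ.- p ∣
    dist-sym p q = trans (cong ∣_∣ (sub-flip p q))
                         (ℚ.∣-p∣≡∣p∣ (q ℚ.- p))

    triangle : ∀ p q r {s t} → ∣ p ℚ.- q ∣ ℚ.≤ s → ∣ q ℚ.- r ∣ ℚ.≤ t → ∣ p ℚ.- r ∣ ℚ.≤ s ℚ.+ t
    triangle p q r {s} {t} pq qr = begin
      ∣ p ℚ.- r ∣                    ≡⟨ cong ∣_∣ (sub-telescope p q r) ⟩
      ∣ (p ℚ.- q) ℚ.+ (q ℚ.- r) ∣    ≤⟨ ℚ.∣p+q∣≤∣p∣+∣q∣ (p ℚ.- q) (q ℚ.- r) ⟩
      ∣ p ℚ.- q ∣ ℚ.+ ∣ q ℚ.- r ∣    ≤⟨ ℚ.+-mono-≤ pq qr ⟩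
      s ℚ.+ t                        ∎
      where open ℚ.≤-Reasoning

    *-mono-≤-abs : ∀ p q s t → ∣ p ∣ ℚ.≤ s → ∣ q ∣ ℚ.≤ t → ∣ p ℚ.* q ∣ ℚ.≤ s ℚ.* t
    *-mono-≤-abs p q s t p≤s q≤t = begin
      ∣ p ℚ.* q ∣        ≡⟨ ℚ.∣p*q∣≡∣p∣*∣q∣ p q ⟩
      ∣ p ∣ ℚ.* ∣ q ∣    ≤⟨ ℚ.*-monoˡ-≤-nonNeg ∣ p ∣ {{ℚ.∣-∣-nonNeg p}} q≤t ⟩
      ∣ p ∣ ℚ.* t        ≤⟨ ℚ.*-monoʳ-≤-nonNeg t {{nonNegative (ℚ.≤-trans (ℚ.0≤∣p∣ q) q≤t)}} p≤s ⟩
      s ℚ.* t            ∎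
      where open ℚ.≤-Reasoning

    *-pos : ∀ {p q} → 0ℚ ℚ.< p → 0ℚ ℚ.< q → 0ℚ ℚ.< p ℚ.* q
    *-pos {p} {q} 0<p 0<q =
      ℚ.positive⁻¹ (p ℚ.* q) {{ℚ.pos*pos⇒pos p {{positive 0<p}} q {{positive 0<q}}}}

    +-pos : ∀ {p q} → 0ℚ ℚ.< p → 0ℚ ℚ.< q → 0ℚ ℚ.< p ℚ.+ q
    +-pos 0<p 0<q = ℚ.+-mono-< 0<p 0<q

    0<1 : 0ℚ ℚ.< 1ℚ
    0<1 = ℚ.positive⁻¹ 1ℚ

    recip : ∀ {p} → 0ℚ ℚ.< p → ∃[ q ] (0ℚ ℚ.< q × p ℚ.* q ≡ 1ℚ)
    recip {p} 0<p = (ℚ.1/ p) , ℚ.positive⁻¹ _ {{ℚ.1/pos⇒pos p}} , ℚ.*-inverseʳ p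
      where instance
        p-pos = positive 0<p
        p≢0   = ℚ.pos⇒nonZero p

    halve : ∀ {ε} → 0ℚ ℚ.< ε → ∃[ δ ] (0ℚ ℚ.< δ × δ ℚ.+ δ ≡ ε)
    halve {ε} 0<ε = ½ ℚ.* ε , *-pos (ℚ.positive⁻¹ ½) 0<ε ,
      trans (sym (ℚ.*-distribʳ-+ ε ½ ½)) (ℚ.*-identityˡ ε)

    eighth : ∀ {ε} → 0ℚ ℚ.< ε → ∃[ δ ] (0ℚ ℚ.< δ ×
      ((δ ℚ.+ δ) ℚ.+ (δ ℚ.+ δ)) ℚ.+ ((δ ℚ.+ δ) ℚ.+ (δ ℚ.+ δ)) ≡ ε)
    eighth 0<ε with halve 0<ε
    ... | _ , 0<ε/2 , refl with halve 0<ε/2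
    ... | _ , 0<ε/4 , refl with halve 0<ε/4
    ... | δ , 0<δ , refl = δ , 0<δ , refl

    p≤p+q : ∀ p {q} → 0ℚ ℚ.≤ q → p ℚ.≤ p ℚ.+ q
    p≤p+q p 0≤q = ℚ.≤-trans (ℚ.≤-reflexive (sym (ℚ.+-identityʳ p))) (ℚ.+-monoʳ-≤ p 0≤q)

    +-cancelʳ-≤ : ∀ {p q} r → p ℚ.+ r ℚ.≤ q ℚ.+ r → p ℚ.≤ q
    +-cancelʳ-≤ {p} {q} r h = begin
      p                      ≡⟨ add-sub p r ⟩
      (p ℚ.+ r) ℚ.- r        ≤⟨ ℚ.+-monoˡ-≤ (ℚ.- r) h ⟩
      (q ℚ.+ r) ℚ.- r        ≡⟨ add-sub q r ⟨
      q                      ∎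
      where
      open ℚ.≤-Reasoning

    dist-0 : ∀ p → p ℚ.- 0ℚ ≡ p
    dist-0 p = ℚ.+-identityʳ p

    ≰⇒≥ : ∀ {p q} → ¬ (p ℚ.≤ q) → q ℚ.≤ p
    ≰⇒≥ p≰q = ℚ.<⇒≤ (ℚ.≰⇒> p≰q)

    prod-close : ∀ a b c d B C ε → ∣ a ∣ ℚ.≤ B → ∣ d ∣ ℚ.≤ C →
                 ∣ b ℚ.- d ∣ ℚ.≤ ε → ∣ a ℚ.- c ∣ ℚ.≤ ε →
                 ∣ a ℚ.* b ℚ.- c ℚ.* d ∣ ℚ.≤ (B ℚ.+ C) ℚ.* ε
    prod-close a b c d B C ε a≤B d≤C bd ac = begin
      ∣ a ℚ.* b ℚ.- c ℚ.* d ∣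
        ≡⟨ cong ∣_∣ (sub-* a b c d) ⟩
      ∣ a ℚ.* (b ℚ.- d) ℚ.+ (a ℚ.- c) ℚ.* d ∣
        ≤⟨ ℚ.∣p+q∣≤∣p∣+∣q∣ (a ℚ.* (b ℚ.- d)) ((a ℚ.- c) ℚ.* d) ⟩
      ∣ a ℚ.* (b ℚ.- d) ∣ ℚ.+ ∣ (a ℚ.- c) ℚ.* d ∣
        ≤⟨ ℚ.+-mono-≤ (*-mono-≤-abs a (b ℚ.- d) B ε a≤B bd) (*-mono-≤-abs (a ℚ.- c) d ε C ac d≤C) ⟩
      B ℚ.* ε ℚ.+ ε ℚ.* C
        ≡⟨ collect B C ε ⟩
      (B ℚ.+ C) ℚ.* ε ∎
      where open ℚ.≤-Reasoning

  Seq : Set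
  Seq = ℕ → ℚ

  Close : ℚ → Seq → Seq → ℕ → Set
  Close ε x y N = ∀ m n → N ℕ.≤ m → N ℕ.≤ n → ∣ x m ℚ.- y n ∣ ℚ.≤ ε

  infix 4 _~_

  -- A partial equivalence relation.  Its diagonal is the Cauchy condition,
  -- and between Cauchy sequences it says that xₙ - yₙ tends to 0.
  _~_ : Seq → Seq → Set
  x ~ y = ∀ ε → 0ℚ ℚ.< ε → ∃ (Close ε x y)

  Cauchy : Seq → Set
  Cauchy x = x ~ x

  record ℝ : Set where
    constructor mkℝ
    field
      seq    : Seq
      cauchy : Cauchy seq

  open ℝ public

  infix 4 _≈_ _#_

  _≈_ : ℝ → ℝ → Set
  x ≈ y = seq x ~ seq y

  -- x ≠ y in the positive form that division needs; tight for ≈ (#-tight),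
  -- hence classically equivalent to ¬ (x ≈ y).
  _#_ : ℝ → ℝ → Set
  x # y = ∃[ ε ] (0ℚ ℚ.< ε × ∃[ N ] (∀ n → N ℕ.≤ n → ε ℚ.≤ ∣ seq x n ℚ.- seq y n ∣))

  private
    ~-sym : ∀ {x y} → x ~ y → y ~ x
    ~-sym {x} {y} x~y ε 0<ε with x~y ε 0<ε
    ... | N , close = N , λ m n N≤m N≤n →
      subst (ℚ._≤ ε) (dist-sym (x n) (y m)) (close n m N≤n N≤m)

    ~-trans : ∀ {x y z} → x ~ y → y ~ z → x ~ z
    ~-trans {x} {y} {z} x~y y~z ε 0<ε with halve 0<ε
    ... | δ , 0<δ , refl with x~y δ 0<δ | y~z δ 0<δ
    ... | M , xy | N , yz = M ℕ.⊔ N , λ m n m≥ n≥ →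
      let l = M ℕ.⊔ N in
      triangle (x m) (y l) (z n) (xy m l (ℕ.m⊔n≤o⇒m≤o M N m≥) (ℕ.m≤m⊔n M N))
               (yz l n (ℕ.m≤n⊔m M N) (ℕ.m⊔n≤o⇒n≤o M N n≥))

    eventually : ∀ {x y z} N → (∀ n → N ℕ.≤ n → x n ≡ y n) → x ~ z → y ~ z
    eventually {z = z} M x≡y x~z ε 0<ε with x~z ε 0<ε
    ... | N , close = M ℕ.⊔ N , λ m n m≥ n≥ →
      subst (λ p → ∣ p ℚ.- z n ∣ ℚ.≤ ε) (x≡y m (ℕ.m⊔n≤o⇒m≤o M N m≥))
        (close m n (ℕ.m⊔n≤o⇒n≤o M N m≥) (ℕ.m⊔n≤o⇒n≤o M N n≥))

    -- constants in front of ε can be absorbed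
    rescale : ∀ {x y} {K} → 0ℚ ℚ.< K → (∀ ε → 0ℚ ℚ.< ε → ∃ (Close (K ℚ.* ε) x y)) → x ~ y
    rescale {x} {y} {K} 0<K h ε 0<ε with recip 0<K
    ... | L , 0<L , KL≡1 = subst (λ e → ∃ (Close e x y)) KLε≡ε (h (L ℚ.* ε) (*-pos 0<L 0<ε))
      where
      KLε≡ε : K ℚ.* (L ℚ.* ε) ≡ ε
      KLε≡ε = trans (sym (ℚ.*-assoc K L ε)) (trans (cong (ℚ._* ε) KL≡1) (ℚ.*-identityˡ ε))

    Bounded : Seq → Set
    Bounded x = ∃[ B ] (0ℚ ℚ.< B × ∃[ N ] (∀ n → N ℕ.≤ n → ∣ x n ∣ ℚ.≤ B))

    bounded : ∀ {x} → Cauchy x → Bounded x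
    bounded {x} c with c 1ℚ 0<1
    ... | N , close = 1ℚ ℚ.+ ∣ x N ∣ , ℚ.+-mono-<-≤ 0<1 (ℚ.0≤∣p∣ (x N)) , N , λ n N≤n →
      subst (λ p → ∣ p ∣ ℚ.≤ 1ℚ ℚ.+ ∣ x N ∣) (dist-0 (x n))
        (triangle (x n) (x N) 0ℚ (close n N N≤n ℕ.≤-refl)
          (ℚ.≤-reflexive (cong ∣_∣ (dist-0 (x N)))))

    +-resp : ∀ {x x′ y y′} → x ~ x′ → y ~ y′ → (λ n → x n ℚ.+ y n) ~ (λ n → x′ n ℚ.+ y′ n)
    +-resp {x} {x′} {y} {y′} x~x′ y~y′ ε 0<ε with halve 0<ε
    ... | δ , 0<δ , refl with x~x′ δ 0<δ | y~y′ δ 0<δ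
    ... | M , cx | N , cy = M ℕ.⊔ N , λ m n m≥ n≥ → begin
      ∣ (x m ℚ.+ y m) ℚ.- (x′ n ℚ.+ y′ n) ∣
        ≡⟨ cong ∣_∣ (sub-+ (x m) (y m) (x′ n) (y′ n)) ⟩
      ∣ (x m ℚ.- x′ n) ℚ.+ (y m ℚ.- y′ n) ∣
        ≤⟨ ℚ.∣p+q∣≤∣p∣+∣q∣ (x m ℚ.- x′ n) (y m ℚ.- y′ n) ⟩
      ∣ x m ℚ.- x′ n ∣ ℚ.+ ∣ y m ℚ.- y′ n ∣
        ≤⟨ ℚ.+-mono-≤ (cx m n (ℕ.m⊔n≤o⇒m≤o M N m≥) (ℕ.m⊔n≤o⇒m≤o M N n≥))
                      (cy m n (ℕ.m⊔n≤o⇒n≤o M N m≥) (ℕ.m⊔n≤o⇒n≤o M N n≥)) ⟩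
      δ ℚ.+ δ ∎
      where open ℚ.≤-Reasoning

    *-resp : ∀ {x x′ y y′} → x ~ x′ → y ~ y′ → (λ n → x n ℚ.* y n) ~ (λ n → x′ n ℚ.* y′ n)
    *-resp {x} {x′} {y} {y′} x~x′ y~y′ =
      bounds (bounded {x} (~-trans {x} {x′} {x} x~x′ (~-sym {x} {x′} x~x′)))
             (bounded {y′} (~-trans {y′} {y} {y′} (~-sym {y} {y′} y~y′) y~y′))
      where
      xy x′y′ : Seq
      xy n   = x n ℚ.* y n
      x′y′ n = x′ n ℚ.* y′ n
      bounds : Bounded x → Bounded y′ → xy ~ x′y′
      bounds (B , 0<B , K , xB) (C , 0<C , L , yC) = rescale {xy} {x′y′} {B ℚ.+ C} (+-pos 0<B 0<C)
        λ ε 0<ε → close ε (x~x′ ε 0<ε) (y~y′ ε 0<ε)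
        where
        close : ∀ ε → ∃ (Close ε x x′) → ∃ (Close ε y y′) → ∃ (Close ((B ℚ.+ C) ℚ.* ε) xy x′y′)
        close ε (M , cx) (N , cy) = (K ℕ.⊔ L) ℕ.⊔ (M ℕ.⊔ N) , λ m n m≥ n≥ →
          let m≥KL = ℕ.m⊔n≤o⇒m≤o (K ℕ.⊔ L) (M ℕ.⊔ N) m≥
              n≥KL = ℕ.m⊔n≤o⇒m≤o (K ℕ.⊔ L) (M ℕ.⊔ N) n≥
              m≥MN = ℕ.m⊔n≤o⇒n≤o (K ℕ.⊔ L) (M ℕ.⊔ N) m≥
              n≥MN = ℕ.m⊔n≤o⇒n≤o (K ℕ.⊔ L) (M ℕ.⊔ N) n≥
          in prod-close (x m) (y m) (x′ n) (y′ n) B C ε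
               (xB m (ℕ.m⊔n≤o⇒m≤o K L m≥KL))
               (yC n (ℕ.m⊔n≤o⇒n≤o K L n≥KL))
               (cy m n (ℕ.m⊔n≤o⇒n≤o M N m≥MN) (ℕ.m⊔n≤o⇒n≤o M N n≥MN))
               (cx m n (ℕ.m⊔n≤o⇒m≤o M N m≥MN) (ℕ.m⊔n≤o⇒m≤o M N n≥MN))

    neg-resp : ∀ {x x′} → x ~ x′ → (λ n → ℚ.- x n) ~ (λ n → ℚ.- x′ n)
    neg-resp {x} {x′} x~x′ ε 0<ε with x~x′ ε 0<ε
    ... | N , close = N , λ m n m≥ n≥ →
      subst (ℚ._≤ ε) (trans (dist-sym (x m) (x′ n)) (cong ∣_∣ (sub-neg (x m) (x′ n)))) (close m n m≥ n≥)

  fromℚ : ℚ → ℝ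
  fromℚ q = mkℝ (λ _ → q) λ ε 0<ε → 0 , λ _ _ _ _ →
    ℚ.≤-trans (ℚ.≤-reflexive (cong ∣_∣ (ℚ.+-inverseʳ q))) (ℚ.<⇒≤ 0<ε)

  infixl 6 _+_
  infixl 7 _*_
  infix  8 -_

  _+_ : ℝ → ℝ → ℝ
  x + y = mkℝ (λ n → seq x n ℚ.+ seq y n) (+-resp {seq x} {seq x} {seq y} {seq y} (cauchy x) (cauchy y))

  _*_ : ℝ → ℝ → ℝ
  x * y = mkℝ (λ n → seq x n ℚ.* seq y n) (*-resp {seq x} {seq x} {seq y} {seq y} (cauchy x) (cauchy y))

  -_ : ℝ → ℝ
  - x = mkℝ (λ n → ℚ.- seq x n) (neg-resp {seq x} {seq x} (cauchy x))

  0ℝ 1ℝ : ℝ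
  0ℝ = fromℚ 0ℚ
  1ℝ = fromℚ 1ℚ

  ≈-refl : ∀ {x} → x ≈ x
  ≈-refl {x} = cauchy x

  ≈-sym : ∀ {x y} → x ≈ y → y ≈ x
  ≈-sym {x} {y} = ~-sym {seq x} {seq y}

  ≈-trans : ∀ {x y z} → x ≈ y → y ≈ z → x ≈ z
  ≈-trans {x} {y} {z} = ~-trans {seq x} {seq y} {seq z}

  ≗⇒≈ : ∀ x y → (∀ n → seq x n ≡ seq y n) → x ≈ y
  ≗⇒≈ x y x≗y = ≈-sym {y} {x} (eventually {seq x} {seq y} {seq x} 0 (λ n _ → x≗y n) (cauchy x))

  +-cong : ∀ {x x′ y y′} → x ≈ x′ → y ≈ y′ → x + y ≈ x′ + y′
  +-cong {x} {x′} {y} {y′} = +-resp {seq x} {seq x′} {seq y} {seq y′}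

  *-cong : ∀ {x x′ y y′} → x ≈ x′ → y ≈ y′ → x * y ≈ x′ * y′
  *-cong {x} {x′} {y} {y′} = *-resp {seq x} {seq x′} {seq y} {seq y′}

  -‿cong : ∀ {x x′} → x ≈ x′ → - x ≈ - x′
  -‿cong {x} {x′} = neg-resp {seq x} {seq x′}

  commutativeRing : CommutativeRing 0ℓ 0ℓ
  commutativeRing = record
    { Carrier = ℝ ; _≈_ = _≈_ ; _+_ = _+_ ; _*_ = _*_ ; -_ = -_ ; 0# = 0ℝ ; 1# = 1ℝ
    ; isCommutativeRing = record
      { isRing = record
        { +-isAbelianGroup = record
          { isGroup = record
            { isMonoid = record
              { isSemigroup = record
                { isMagma = record
                  { isEquivalence = record
                    { refl  = λ {x} → ≈-refl {x}
                    ; sym   = λ {x} {y} → ≈-sym {x} {y}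
                    ; trans = λ {x} {y} {z} → ≈-trans {x} {y} {z}
                    }
                  ; ∙-cong = λ {x} {x′} {y} {y′} → +-cong {x} {x′} {y} {y′}
                  }
                ; assoc = λ x y z → ≗⇒≈ ((x + y) + z) (x + (y + z))
                    λ n → ℚ.+-assoc (seq x n) (seq y n) (seq z n)
                }
              ; identity = (λ x → ≗⇒≈ (0ℝ + x) x λ n → ℚ.+-identityˡ (seq x n))
                         , (λ x → ≗⇒≈ (x + 0ℝ) x λ n → ℚ.+-identityʳ (seq x n))
              }
            ; inverse = (λ x → ≗⇒≈ (- x + x) 0ℝ λ n → ℚ.+-inverseˡ (seq x n))
                      , (λ x → ≗⇒≈ (x + - x) 0ℝ λ n → ℚ.+-inverseʳ (seq x n))
            ; ⁻¹-cong = λ {x} {y} → -‿cong {x} {y}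
            }
          ; comm = λ x y → ≗⇒≈ (x + y) (y + x) λ n → ℚ.+-comm (seq x n) (seq y n)
          }
        ; *-cong = λ {x} {x′} {y} {y′} → *-cong {x} {x′} {y} {y′}
        ; *-assoc = λ x y z → ≗⇒≈ ((x * y) * z) (x * (y * z))
            λ n → ℚ.*-assoc (seq x n) (seq y n) (seq z n)
        ; *-identity = (λ x → ≗⇒≈ (1ℝ * x) x λ n → ℚ.*-identityˡ (seq x n))
                     , (λ x → ≗⇒≈ (x * 1ℝ) x λ n → ℚ.*-identityʳ (seq x n))
        ; distrib = (λ x y z → ≗⇒≈ (x * (y + z)) (x * y + x * z)
                       λ n → ℚ.*-distribˡ-+ (seq x n) (seq y n) (seq z n))
                  , (λ x y z → ≗⇒≈ ((y + z) * x) (y * x + z * x)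
                       λ n → ℚ.*-distribʳ-+ (seq x n) (seq y n) (seq z n))
        }
      ; *-comm = λ x y → ≗⇒≈ (x * y) (y * x) λ n → ℚ.*-comm (seq x n) (seq y n)
      }
    }

  #-irrefl : ∀ {x y} → x ≈ y → ¬ (x # y)
  #-irrefl x≈y (ε , 0<ε , M , apart) with halve 0<ε
  ... | δ , 0<δ , refl with x≈y δ 0<δ
  ... | N , close = ℚ.<-irrefl refl (ℚ.<-≤-trans 0<δ δ≤0)
    where
    l = M ℕ.⊔ N
    δ≤0 : δ ℚ.≤ 0ℚ
    δ≤0 = +-cancelʳ-≤ δ (ℚ.≤-trans (apart l (ℕ.m≤m⊔n M N))
            (ℚ.≤-trans (close l l (ℕ.m≤n⊔m M N) (ℕ.m≤n⊔m M N))
              (ℚ.≤-reflexive (sym (ℚ.+-identityˡ δ)))))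

  #-sym : ∀ {x y} → x # y → y # x
  #-sym {x} {y} (ε , 0<ε , N , apart) = ε , 0<ε , N , λ n n≥ →
    subst (ε ℚ.≤_) (dist-sym (seq x n) (seq y n)) (apart n n≥)

  private
    -- One pair of terms at distance 4δ, past the point from which both
    -- sequences vary by at most δ, separates the two real numbers.
    separate : ∀ x y {δ} M → 0ℚ ℚ.< δ → Close δ (seq x) (seq x) M → Close δ (seq y) (seq y) M →
               (δ ℚ.+ δ) ℚ.+ (δ ℚ.+ δ) ℚ.≤ ∣ seq x M ℚ.- seq y M ∣ → x # y
    separate x y {δ} M 0<δ cx cy far = δ ℚ.+ δ , +-pos 0<δ 0<δ , M , λ n M≤n →
      +-cancelʳ-≤ (δ ℚ.+ δ) (begin
        (δ ℚ.+ δ) ℚ.+ (δ ℚ.+ δ)                    ≤⟨ far ⟩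
        ∣ seq x M ℚ.- seq y M ∣                    ≤⟨ triangle (seq x M) (seq x n) (seq y M) (cx M n ℕ.≤-refl M≤n)
                                                       (triangle (seq x n) (seq y n) (seq y M) ℚ.≤-refl (cy n M M≤n ℕ.≤-refl)) ⟩
        δ ℚ.+ (∣ seq x n ℚ.- seq y n ∣ ℚ.+ δ)      ≡⟨ regroup₁ δ ∣ seq x n ℚ.- seq y n ∣ ⟩
        ∣ seq x n ℚ.- seq y n ∣ ℚ.+ (δ ℚ.+ δ)      ∎)
      where open ℚ.≤-Reasoning

    weaken : ∀ {ε x y N} M → N ℕ.≤ M → Close ε x y N → Close ε x y M
    weaken M N≤M close m n m≥ n≥ = close m n (ℕ.≤-trans N≤M m≥) (ℕ.≤-trans N≤M n≥)

  #-cotrans : ∀ {x y} → x # y → ∀ z → (x # z) ⊎ (z # y)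
  #-cotrans {x} {y} (ε , 0<ε , N , apart) z with eighth 0<ε
  ... | δ , 0<δ , refl with cauchy x δ 0<δ | cauchy y δ 0<δ | cauchy z δ 0<δ
  ... | Nx , cx | Ny , cy | Nz , cz
    with ((δ ℚ.+ δ) ℚ.+ (δ ℚ.+ δ)) ℚ.≤? ∣ seq x ((N ℕ.⊔ Nx) ℕ.⊔ (Ny ℕ.⊔ Nz)) ℚ.- seq z ((N ℕ.⊔ Nx) ℕ.⊔ (Ny ℕ.⊔ Nz)) ∣
  ... | yes far = inj₁ (separate x z ((N ℕ.⊔ Nx) ℕ.⊔ (Ny ℕ.⊔ Nz)) 0<δ
        (weaken {x = seq x} {seq x} _ (ℕ.≤-trans (ℕ.m≤n⊔m N Nx) (ℕ.m≤m⊔n _ _)) cx)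
        (weaken {x = seq z} {seq z} _ (ℕ.≤-trans (ℕ.m≤n⊔m Ny Nz) (ℕ.m≤n⊔m (N ℕ.⊔ Nx) _)) cz) far)
  ... | no near = inj₂ (separate z y M 0<δ
        (weaken {x = seq z} {seq z} _ (ℕ.≤-trans (ℕ.m≤n⊔m Ny Nz) (ℕ.m≤n⊔m (N ℕ.⊔ Nx) _)) cz)
        (weaken {x = seq y} {seq y} _ (ℕ.≤-trans (ℕ.m≤m⊔n Ny Nz) (ℕ.m≤n⊔m (N ℕ.⊔ Nx) _)) cy)
        (+-cancelʳ-≤ δ₄ (ℚ.≤-trans (apart M (ℕ.≤-trans (ℕ.m≤m⊔n N Nx) (ℕ.m≤m⊔n _ _)))
          (ℚ.≤-trans (triangle (seq x M) (seq z M) (seq y M) (≰⇒≥ near) ℚ.≤-refl)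
            (ℚ.≤-reflexive (ℚ.+-comm δ₄ ∣ seq z M ℚ.- seq y M ∣))))))
    where
    M  = (N ℕ.⊔ Nx) ℕ.⊔ (Ny ℕ.⊔ Nz)
    δ₄ = (δ ℚ.+ δ) ℚ.+ (δ ℚ.+ δ)

  #-tight : ∀ x y → ¬ (x # y) → x ≈ y
  #-tight x y ¬x#y ε 0<ε with eighth 0<ε
  ... | δ , 0<δ , refl with cauchy x δ 0<δ | cauchy y δ 0<δ
  ... | Nx , cx | Ny , cy
    with ((δ ℚ.+ δ) ℚ.+ (δ ℚ.+ δ)) ℚ.≤? ∣ seq x (Nx ℕ.⊔ Ny) ℚ.- seq y (Nx ℕ.⊔ Ny) ∣
  ... | yes far = ⊥-elim (¬x#y (separate x y (Nx ℕ.⊔ Ny) 0<δ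
          (weaken {x = seq x} {seq x} _ (ℕ.m≤m⊔n Nx Ny) cx)
          (weaken {x = seq y} {seq y} _ (ℕ.m≤n⊔m Nx Ny) cy) far))
  ... | no near = M , λ m n m≥ n≥ → begin
      ∣ seq x m ℚ.- seq y n ∣
        ≤⟨ triangle (seq x m) (seq x M) (seq y n) (cx m M (ℕ.m⊔n≤o⇒m≤o Nx Ny m≥) (ℕ.m≤m⊔n Nx Ny))
             (triangle (seq x M) (seq y M) (seq y n) (≰⇒≥ near) (cy M n (ℕ.m≤n⊔m Nx Ny) (ℕ.m⊔n≤o⇒n≤o Nx Ny n≥))) ⟩
      δ ℚ.+ (δ₄ ℚ.+ δ)
        ≤⟨ p≤p+q (δ ℚ.+ (δ₄ ℚ.+ δ)) (ℚ.<⇒≤ (+-pos 0<δ 0<δ)) ⟩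
      (δ ℚ.+ (δ₄ ℚ.+ δ)) ℚ.+ (δ ℚ.+ δ)
        ≡⟨ regroup₂ δ δ₄ ⟩
      δ₄ ℚ.+ δ₄ ∎
    where
    open ℚ.≤-Reasoning
    M  = Nx ℕ.⊔ Ny
    δ₄ = (δ ℚ.+ δ) ℚ.+ (δ ℚ.+ δ)

  private
    -- the value at 0 is immaterial
    recip₀ : ℚ → ℚ
    recip₀ p with p ℚ.≟ 0ℚ
    ... | yes _   = 0ℚ
    ... | no  p≢0 = (ℚ.1/ p) {{≢-nonZero p≢0}}

    recip₀-inverse : ∀ {ε} p → 0ℚ ℚ.< ε → ε ℚ.≤ ∣ p ∣ → recip₀ p ℚ.* p ≡ 1ℚ
    recip₀-inverse {ε} p 0<ε ε≤∣p∣ with p ℚ.≟ 0ℚ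
    ... | yes refl = ⊥-elim (ℚ.<-irrefl refl (ℚ.<-≤-trans 0<ε ε≤∣p∣))
    ... | no  p≢0  = ℚ.*-inverseˡ p {{≢-nonZero p≢0}}

    recip₀-bound : ∀ {ε η} p → 0ℚ ℚ.< ε → 0ℚ ℚ.< η → ε ℚ.* η ≡ 1ℚ → ε ℚ.≤ ∣ p ∣ → ∣ recip₀ p ∣ ℚ.≤ η
    recip₀-bound {ε} {η} p 0<ε 0<η εη≡1 ε≤∣p∣ =
      ℚ.*-cancelʳ-≤-pos ε {{positive 0<ε}} (begin
        ∣ recip₀ p ∣ ℚ.* ε        ≤⟨ ℚ.*-monoˡ-≤-nonNeg ∣ recip₀ p ∣ {{ℚ.∣-∣-nonNeg (recip₀ p)}} ε≤∣p∣ ⟩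
        ∣ recip₀ p ∣ ℚ.* ∣ p ∣    ≡⟨ ℚ.∣p*q∣≡∣p∣*∣q∣ (recip₀ p) p ⟨
        ∣ recip₀ p ℚ.* p ∣        ≡⟨ cong ∣_∣ (recip₀-inverse p 0<ε ε≤∣p∣) ⟩
        1ℚ                        ≡⟨ εη≡1 ⟨
        ε ℚ.* η                   ≡⟨ ℚ.*-comm ε η ⟩
        η ℚ.* ε                   ∎)
      where open ℚ.≤-Reasoning

    recip₀-close : ∀ {ε η} p q δ → 0ℚ ℚ.< ε → 0ℚ ℚ.< η → ε ℚ.* η ≡ 1ℚ → ε ℚ.≤ ∣ p ∣ → ε ℚ.≤ ∣ q ∣ →
                   ∣ q ℚ.- p ∣ ℚ.≤ δ → ∣ recip₀ p ℚ.- recip₀ q ∣ ℚ.≤ (η ℚ.* η) ℚ.* δ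
    recip₀-close {ε} {η} p q δ 0<ε 0<η εη≡1 p≥ε q≥ε qp = begin
      ∣ recip₀ p ℚ.- recip₀ q ∣
        ≡⟨ cong ∣_∣ factor ⟩
      ∣ (recip₀ p ℚ.* recip₀ q) ℚ.* (q ℚ.- p) ∣
        ≤⟨ *-mono-≤-abs (recip₀ p ℚ.* recip₀ q) (q ℚ.- p) (η ℚ.* η) δ
             (*-mono-≤-abs (recip₀ p) (recip₀ q) η η
               (recip₀-bound p 0<ε 0<η εη≡1 p≥ε) (recip₀-bound q 0<ε 0<η εη≡1 q≥ε)) qp ⟩
      (η ℚ.* η) ℚ.* δ ∎
      where
      open ℚ.≤-Reasoning
      expand : ∀ r q → ε ℚ.≤ ∣ q ∣ → r ≡ r ℚ.* (recip₀ q ℚ.* q)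
      expand r q q≥ε = trans (sym (ℚ.*-identityʳ r)) (cong (r ℚ.*_) (sym (recip₀-inverse q 0<ε q≥ε)))
      factor : recip₀ p ℚ.- recip₀ q ≡ (recip₀ p ℚ.* recip₀ q) ℚ.* (q ℚ.- p)
      factor = trans (cong₂ ℚ._-_ (expand (recip₀ p) q q≥ε) (expand (recip₀ q) p p≥ε))
                     (sub-cross (recip₀ p) (recip₀ q) p q)

  #⇒inverse : ∀ x y → x # y → ∃[ w ] (w * (x + - y) ≈ 1ℝ)
  #⇒inverse x y (ε , 0<ε , N , apart) = w ,
    eventually {seq 1ℝ} {seq (w * z)} {seq 1ℝ} N
      (λ n n≥ → sym (recip₀-inverse (seq z n) 0<ε (apart n n≥))) (cauchy 1ℝ)
    where
    z : ℝ
    z = x + - y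
    u : Seq
    u n = recip₀ (seq z n)
    w : ℝ
    w = mkℝ u (recip-cauchy (recip 0<ε))
      where
      recip-cauchy : ∃[ η ] (0ℚ ℚ.< η × ε ℚ.* η ≡ 1ℚ) → Cauchy u
      recip-cauchy (η , 0<η , εη≡1) = rescale {u} {u} {η ℚ.* η} (*-pos 0<η 0<η)
        λ δ 0<δ → close δ (cauchy z δ 0<δ)
        where
        close : ∀ δ → ∃ (Close δ (seq z) (seq z)) → ∃ (Close ((η ℚ.* η) ℚ.* δ) u u)
        close δ (M , cz) = N ℕ.⊔ M , λ m n m≥ n≥ →
          recip₀-close (seq z m) (seq z n) δ 0<ε 0<η εη≡1
            (apart m (ℕ.m⊔n≤o⇒m≤o N M m≥)) (apart n (ℕ.m⊔n≤o⇒m≤o N M n≥))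
            (cz n m (ℕ.m⊔n≤o⇒n≤o N M n≥) (ℕ.m⊔n≤o⇒n≤o N M m≥))

  private
    0<½ : 0ℚ ℚ.< ½
    0<½ = ℚ.positive⁻¹ ½

    half≤ : ∀ p → ∣ p ℚ.- 1ℚ ∣ ℚ.≤ ½ → ½ ℚ.≤ ∣ p ∣
    half≤ p h = +-cancelʳ-≤ ½ (begin
      1ℚ                          ≤⟨ triangle 1ℚ p 0ℚ (subst (ℚ._≤ ½) (dist-sym p 1ℚ) h) ℚ.≤-refl ⟩
      ½ ℚ.+ ∣ p ℚ.- 0ℚ ∣          ≡⟨ cong (λ q → ½ ℚ.+ ∣ q ∣) (dist-0 p) ⟩
      ½ ℚ.+ ∣ p ∣                 ≡⟨ ℚ.+-comm ½ ∣ p ∣ ⟩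
      ∣ p ∣ ℚ.+ ½                 ∎)
      where open ℚ.≤-Reasoning

    factor-bound : ∀ {B C} p q → 0ℚ ℚ.< B → B ℚ.* C ≡ 1ℚ → ∣ p ∣ ℚ.≤ B →
                   ∣ p ℚ.* q ℚ.- 1ℚ ∣ ℚ.≤ ½ → C ℚ.* ½ ℚ.≤ ∣ q ∣
    factor-bound {B} {C} p q 0<B BC≡1 p≤B pq = ℚ.*-cancelˡ-≤-pos B {{positive 0<B}} (begin
      B ℚ.* (C ℚ.* ½)     ≡⟨ ℚ.*-assoc B C ½ ⟨
      (B ℚ.* C) ℚ.* ½     ≡⟨ cong (ℚ._* ½) BC≡1 ⟩
      ½                   ≤⟨ half≤ (p ℚ.* q) pq ⟩
      ∣ p ℚ.* q ∣         ≤⟨ *-mono-≤-abs p q B ∣ q ∣ p≤B ℚ.≤-refl ⟩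
      B ℚ.* ∣ q ∣         ∎)
      where open ℚ.≤-Reasoning

  inverse⇒# : ∀ x y w → w * (x + - y) ≈ 1ℝ → x # y
  inverse⇒# x y w wz≈1 = result (bounded {seq w} (cauchy w)) (wz≈1 ½ 0<½)
    where
    result : Bounded (seq w) → ∃ (Close ½ (seq (w * (x + - y))) (seq 1ℝ)) → x # y
    result (B , 0<B , M , wB) (N , close) = apart (recip 0<B)
      where
      apart : ∃[ C ] (0ℚ ℚ.< C × B ℚ.* C ≡ 1ℚ) → x # y
      apart (C , 0<C , BC≡1) = C ℚ.* ½ , *-pos 0<C 0<½ , M ℕ.⊔ N , λ n n≥ →
        factor-bound (seq w n) (seq x n ℚ.- seq y n) 0<B BC≡1 (wB n (ℕ.m⊔n≤o⇒m≤o M N n≥))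
          (close n n (ℕ.m⊔n≤o⇒n≤o M N n≥) (ℕ.m⊔n≤o⇒n≤o M N n≥))

  heytingField : HeytingField 0ℓ 0ℓ 0ℓ
  heytingField = record
    { Carrier = ℝ ; _≈_ = _≈_ ; _#_ = _#_ ; _+_ = _+_ ; _*_ = _*_ ; -_ = -_ ; 0# = 0ℝ ; 1# = 1ℝ
    ; isHeytingField = record
      { isHeytingCommutativeRing = record
        { isCommutativeRing = CommutativeRing.isCommutativeRing commutativeRing
        ; isApartnessRelation = record
          { irrefl  = λ {x} {y} → #-irrefl {x} {y}
          ; sym     = λ {x} {y} → #-sym {x} {y}
          ; cotrans = λ {x} {y} → #-cotrans {x} {y}
          }
        ; #⇒invertible = λ {x} {y} x#y → let w , wz≈1 = #⇒inverse x y x#y in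
            w , wz≈1 , ≈-trans {(x + - y) * w} {w * (x + - y)} {1ℝ} (≗⇒≈ ((x + - y) * w) (w * (x + - y))
              λ n → ℚ.*-comm (seq x n ℚ.- seq y n) (seq w n)) wz≈1
        ; invertible⇒# = λ {x} {y} (w , wz≈1 , _) → inverse⇒# x y w wz≈1
        }
      ; tight = λ x y → #-tight x y , #-irrefl {x} {y}
      }
    }

  private
    square≥0 : ∀ p → 0ℚ ℚ.≤ p ℚ.* p
    square≥0 p = subst (0ℚ ℚ.≤_) (abs-square (ℚ.∣p∣≡p∨∣p∣≡-p p))
      (ℚ.nonNegative⁻¹ (∣ p ∣ ℚ.* ∣ p ∣) {{ℚ.nonNeg*nonNeg⇒nonNeg ∣ p ∣ ∣ p ∣}})
      where
      instance _ = ℚ.∣-∣-nonNeg p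
      abs-square : ∣ p ∣ ≡ p ⊎ ∣ p ∣ ≡ ℚ.- p → ∣ p ∣ ℚ.* ∣ p ∣ ≡ p ℚ.* p
      abs-square (inj₁ eq) = cong₂ ℚ._*_ eq eq
      abs-square (inj₂ eq) = trans (cong₂ ℚ._*_ eq eq) (solve 1 (λ a → (:- a) :* (:- a) := a :* a) refl p)

    norm-bound : ∀ {ε} p q → 0ℚ ℚ.≤ ε → ε ℚ.≤ ∣ p ∣ → ε ℚ.* ε ℚ.≤ ∣ (p ℚ.* p ℚ.+ q ℚ.* q) ℚ.- 0ℚ ∣
    norm-bound {ε} p q 0≤ε ε≤p = begin
      ε ℚ.* ε                                  ≤⟨ ℚ.*-monoˡ-≤-nonNeg ε {{nonNegative 0≤ε}} ε≤p ⟩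
      ε ℚ.* ∣ p ∣                              ≤⟨ ℚ.*-monoʳ-≤-nonNeg ∣ p ∣ {{ℚ.∣-∣-nonNeg p}} ε≤p ⟩
      ∣ p ∣ ℚ.* ∣ p ∣                          ≡⟨ ℚ.∣p*q∣≡∣p∣*∣q∣ p p ⟨
      ∣ p ℚ.* p ∣                              ≡⟨ ℚ.0≤p⇒∣p∣≡p (square≥0 p) ⟩
      p ℚ.* p                                  ≤⟨ p≤p+q (p ℚ.* p) (square≥0 q) ⟩
      p ℚ.* p ℚ.+ q ℚ.* q                      ≡⟨ ℚ.0≤p⇒∣p∣≡p (ℚ.+-mono-≤ (square≥0 p) (square≥0 q)) ⟨
      ∣ p ℚ.* p ℚ.+ q ℚ.* q ∣                  ≡⟨ cong ∣_∣ (dist-0 (p ℚ.* p ℚ.+ q ℚ.* q)) ⟨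
      ∣ (p ℚ.* p ℚ.+ q ℚ.* q) ℚ.- 0ℚ ∣         ∎
      where open ℚ.≤-Reasoning

  norm#0 : ∀ x y s t → x # y ⊎ s # t →
           (x + - y) * (x + - y) + (s + - t) * (s + - t) # 0ℝ
  norm#0 x y s t (inj₁ (ε , 0<ε , N , apart)) = ε ℚ.* ε , *-pos 0<ε 0<ε , N , λ n n≥ →
    norm-bound (seq x n ℚ.- seq y n) (seq s n ℚ.- seq t n) (ℚ.<⇒≤ 0<ε) (apart n n≥)
  norm#0 x y s t (inj₂ (ε , 0<ε , N , apart)) = ε ℚ.* ε , *-pos 0<ε 0<ε , N , λ n n≥ →
    let p = seq x n ℚ.- seq y n ; q = seq s n ℚ.- seq t n in
    subst (λ r → ε ℚ.* ε ℚ.≤ ∣ r ℚ.- 0ℚ ∣) (ℚ.+-comm (q ℚ.* q) (p ℚ.* p))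
      (norm-bound q p (ℚ.<⇒≤ 0<ε) (apart n n≥))

------------------------------------------------------------------------
-- Complex numbers

module Complex where

  open Real using (ℝ; seq; 0ℝ; 1ℝ; ≗⇒≈)
  open +-*-Solver

  record ℂ : Set where
    constructor _+i_
    field
      re im : ℝ

  open ℂ public

  infix  4 _≈_ _#_
  infixl 6 _+_
  infixl 7 _*_
  infix  8 -_

  _≈_ : ℂ → ℂ → Set
  z ≈ w = (re z Real.≈ re w) × (im z Real.≈ im w)

  _#_ : ℂ → ℂ → Set
  z # w = (re z Real.# re w) ⊎ (im z Real.# im w)

  _+_ : ℂ → ℂ → ℂ
  z + w = (re z Real.+ re w) +i (im z Real.+ im w)

  _*_ : ℂ → ℂ → ℂ
  z * w = (re z Real.* re w Real.+ Real.- (im z Real.* im w))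
       +i (re z Real.* im w Real.+ im z Real.* re w)

  -_ : ℂ → ℂ
  - z = (Real.- re z) +i (Real.- im z)

  0ℂ 1ℂ : ℂ
  0ℂ = 0ℝ +i 0ℝ
  1ℂ = 1ℝ +i 0ℝ

  private
    module ℝ-field = HeytingField Real.heytingField

    pointwise : ∀ z w → (∀ n → seq (re z) n ≡ seq (re w) n) → (∀ n → seq (im z) n ≡ seq (im w) n) → z ≈ w
    pointwise z w p q = ≗⇒≈ (re z) (re w) p , ≗⇒≈ (im z) (im w) q

    *-assoc-re : ∀ a b c d e f →
      (a ℚ.* c ℚ.- b ℚ.* d) ℚ.* e ℚ.- (a ℚ.* d ℚ.+ b ℚ.* c) ℚ.* f ≡
      a ℚ.* (c ℚ.* e ℚ.- d ℚ.* f) ℚ.- b ℚ.* (c ℚ.* f ℚ.+ d ℚ.* e)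
    *-assoc-re = solve 6 (λ a b c d e f →
      (a :* c :- b :* d) :* e :- (a :* d :+ b :* c) :* f :=
      a :* (c :* e :- d :* f) :- b :* (c :* f :+ d :* e)) refl

    *-assoc-im : ∀ a b c d e f →
      (a ℚ.* c ℚ.- b ℚ.* d) ℚ.* f ℚ.+ (a ℚ.* d ℚ.+ b ℚ.* c) ℚ.* e ≡
      a ℚ.* (c ℚ.* f ℚ.+ d ℚ.* e) ℚ.+ b ℚ.* (c ℚ.* e ℚ.- d ℚ.* f)
    *-assoc-im = solve 6 (λ a b c d e f →
      (a :* c :- b :* d) :* f :+ (a :* d :+ b :* c) :* e :=
      a :* (c :* f :+ d :* e) :+ b :* (c :* e :- d :* f)) refl

    distrib-re : ∀ a b c d e f →
      a ℚ.* (c ℚ.+ e) ℚ.- b ℚ.* (d ℚ.+ f) ≡ (a ℚ.* c ℚ.- b ℚ.* d) ℚ.+ (a ℚ.* e ℚ.- b ℚ.* f)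
    distrib-re = solve 6 (λ a b c d e f →
      a :* (c :+ e) :- b :* (d :+ f) := (a :* c :- b :* d) :+ (a :* e :- b :* f)) refl

    distrib-im : ∀ a b c d e f →
      a ℚ.* (d ℚ.+ f) ℚ.+ b ℚ.* (c ℚ.+ e) ≡ (a ℚ.* d ℚ.+ b ℚ.* c) ℚ.+ (a ℚ.* f ℚ.+ b ℚ.* e)
    distrib-im = solve 6 (λ a b c d e f →
      a :* (d :+ f) :+ b :* (c :+ e) := (a :* d :+ b :* c) :+ (a :* f :+ b :* e)) refl

    *-comm-re : ∀ a b c d → a ℚ.* c ℚ.- b ℚ.* d ≡ c ℚ.* a ℚ.- d ℚ.* b
    *-comm-re = solve 4 (λ a b c d → a :* c :- b :* d := c :* a :- d :* b) refl

    *-comm-im : ∀ a b c d → a ℚ.* d ℚ.+ b ℚ.* c ≡ c ℚ.* b ℚ.+ d ℚ.* a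
    *-comm-im = solve 4 (λ a b c d → a :* d :+ b :* c := c :* b :+ d :* a) refl

    *-identityˡ-re : ∀ a b → 1ℚ ℚ.* a ℚ.- 0ℚ ℚ.* b ≡ a
    *-identityˡ-re = solve 2 (λ a b → con 1ℚ :* a :- con 0ℚ :* b := a) refl

    *-identityˡ-im : ∀ a b → 1ℚ ℚ.* b ℚ.+ 0ℚ ℚ.* a ≡ b
    *-identityˡ-im = solve 2 (λ a b → con 1ℚ :* b :+ con 0ℚ :* a := b) refl

    inverse-re : ∀ a b t → (a ℚ.* t) ℚ.* a ℚ.- (ℚ.- (b ℚ.* t)) ℚ.* b ≡ t ℚ.* ((a ℚ.* a ℚ.+ b ℚ.* b) ℚ.- 0ℚ)
    inverse-re = solve 3 (λ a b t →
      (a :* t) :* a :- (:- (b :* t)) :* b := t :* ((a :* a :+ b :* b) :- con 0ℚ)) refl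

    inverse-im : ∀ a b t → (a ℚ.* t) ℚ.* b ℚ.+ (ℚ.- (b ℚ.* t)) ℚ.* a ≡ 0ℚ
    inverse-im = solve 3 (λ a b t → (a :* t) :* b :+ (:- (b :* t)) :* a := con 0ℚ) refl

    unit-sub : ∀ p → 1ℚ ℚ.* (p ℚ.- 0ℚ) ≡ p
    unit-sub = solve 1 (λ p → con 1ℚ :* (p :- con 0ℚ) := p) refl

    factor-re : ∀ t c a → (t ℚ.* c) ℚ.* a ≡ t ℚ.* (c ℚ.* a ℚ.- 0ℚ)
    factor-re = solve 3 (λ t c a → (t :* c) :* a := t :* (c :* a :- con 0ℚ)) refl

    factor-im : ∀ t p d b → (ℚ.- (t ℚ.* d)) ℚ.* b ≡ t ℚ.* ((p ℚ.- d ℚ.* b) ℚ.- p)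
    factor-im = solve 4 (λ t p d b → (:- (t :* d)) :* b := t :* ((p :- d :* b) :- p)) refl

  *-comm : ∀ z w → z * w ≈ w * z
  *-comm z w = pointwise (z * w) (w * z)
    (λ n → *-comm-re (seq (re z) n) (seq (im z) n) (seq (re w) n) (seq (im w) n))
    (λ n → *-comm-im (seq (re z) n) (seq (im z) n) (seq (re w) n) (seq (im w) n))

  *-identityˡ : ∀ z → 1ℂ * z ≈ z
  *-identityˡ z = pointwise (1ℂ * z) z
    (λ n → *-identityˡ-re (seq (re z) n) (seq (im z) n))
    (λ n → *-identityˡ-im (seq (re z) n) (seq (im z) n))

  *-assoc : ∀ z w v → (z * w) * v ≈ z * (w * v)
  *-assoc z w v = pointwise ((z * w) * v) (z * (w * v))
    (λ n → *-assoc-re (seq (re z) n) (seq (im z) n) (seq (re w) n) (seq (im w) n) (seq (re v) n) (seq (im v) n))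
    (λ n → *-assoc-im (seq (re z) n) (seq (im z) n) (seq (re w) n) (seq (im w) n) (seq (re v) n) (seq (im v) n))

  *-distribˡ-+ : ∀ z w v → z * (w + v) ≈ z * w + z * v
  *-distribˡ-+ z w v = pointwise (z * (w + v)) (z * w + z * v)
    (λ n → distrib-re (seq (re z) n) (seq (im z) n) (seq (re w) n) (seq (im w) n) (seq (re v) n) (seq (im v) n))
    (λ n → distrib-im (seq (re z) n) (seq (im z) n) (seq (re w) n) (seq (im w) n) (seq (re v) n) (seq (im v) n))

  ≈-sym : ∀ {z w} → z ≈ w → w ≈ z
  ≈-sym {z} {w} (p , q) = Real.≈-sym {re z} {re w} p , Real.≈-sym {im z} {im w} q

  ≈-trans : ∀ {z w v} → z ≈ w → w ≈ v → z ≈ v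
  ≈-trans {z} {w} {v} (p , q) (p′ , q′) =
    Real.≈-trans {re z} {re w} {re v} p p′ , Real.≈-trans {im z} {im w} {im v} q q′

  +-cong : ∀ {z z′ w w′} → z ≈ z′ → w ≈ w′ → z + w ≈ z′ + w′
  +-cong {z} {z′} {w} {w′} (p , q) (p′ , q′) =
    Real.+-cong {re z} {re z′} {re w} {re w′} p p′ , Real.+-cong {im z} {im z′} {im w} {im w′} q q′

  *-cong : ∀ {z z′ w w′} → z ≈ z′ → w ≈ w′ → z * w ≈ z′ * w′
  *-cong {a +i b} {a′ +i b′} {c +i d} {c′ +i d′} (a≈ , b≈) (c≈ , d≈) =
    Real.+-cong {a Real.* c} {a′ Real.* c′} {Real.- (b Real.* d)} {Real.- (b′ Real.* d′)}
      (Real.*-cong {a} {a′} {c} {c′} a≈ c≈)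
      (Real.-‿cong {b Real.* d} {b′ Real.* d′} (Real.*-cong {b} {b′} {d} {d′} b≈ d≈)) ,
    Real.+-cong {a Real.* d} {a′ Real.* d′} {b Real.* c} {b′ Real.* c′}
      (Real.*-cong {a} {a′} {d} {d′} a≈ d≈) (Real.*-cong {b} {b′} {c} {c′} b≈ c≈)

  commutativeRing : CommutativeRing 0ℓ 0ℓ
  commutativeRing = record
    { Carrier = ℂ ; _≈_ = _≈_ ; _+_ = _+_ ; _*_ = _*_ ; -_ = -_ ; 0# = 0ℂ ; 1# = 1ℂ
    ; isCommutativeRing = record
      { isRing = record
        { +-isAbelianGroup = record
          { isGroup = record
            { isMonoid = record
              { isSemigroup = record
                { isMagma = record
                  { isEquivalence = record
                    { refl  = λ {z} → Real.≈-refl {re z} , Real.≈-refl {im z}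
                    ; sym   = λ {z} {w} → ≈-sym {z} {w}
                    ; trans = λ {z} {w} {v} → ≈-trans {z} {w} {v}
                    }
                  ; ∙-cong = λ {z} {z′} {w} {w′} → +-cong {z} {z′} {w} {w′}
                  }
                ; assoc = λ z w v → ℝ-field.+-assoc (re z) (re w) (re v) , ℝ-field.+-assoc (im z) (im w) (im v)
                }
              ; identity = (λ z → ℝ-field.+-identityˡ (re z) , ℝ-field.+-identityˡ (im z))
                         , (λ z → ℝ-field.+-identityʳ (re z) , ℝ-field.+-identityʳ (im z))
              }
            ; inverse = (λ z → ℝ-field.-‿inverseˡ (re z) , ℝ-field.-‿inverseˡ (im z))
                      , (λ z → ℝ-field.-‿inverseʳ (re z) , ℝ-field.-‿inverseʳ (im z))
            ; ⁻¹-cong = λ {z} {w} (p , q) → Real.-‿cong {re z} {re w} p , Real.-‿cong {im z} {im w} q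
            }
          ; comm = λ z w → ℝ-field.+-comm (re z) (re w) , ℝ-field.+-comm (im z) (im w)
          }
        ; *-cong = λ {z} {z′} {w} {w′} → *-cong {z} {z′} {w} {w′}
        ; *-assoc = *-assoc
        ; *-identity = *-identityˡ , λ z → ≈-trans {z * 1ℂ} {1ℂ * z} {z} (*-comm z 1ℂ) (*-identityˡ z)
        ; distrib = *-distribˡ-+ , λ z w v →
            ≈-trans {(w + v) * z} {z * (w + v)} {w * z + v * z} (*-comm (w + v) z)
              (≈-trans {z * (w + v)} {z * w + z * v} {w * z + v * z} (*-distribˡ-+ z w v)
                (+-cong {z * w} {w * z} {z * v} {v * z} (*-comm z w) (*-comm z v)))
        }
      ; *-comm = *-comm
      }
    }

  #-cotrans : ∀ {z w} → z # w → ∀ v → (z # v) ⊎ (v # w)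
  #-cotrans {z} {w} (inj₁ p) v = Sum.map inj₁ inj₁ (Real.#-cotrans {re z} {re w} p (re v))
  #-cotrans {z} {w} (inj₂ p) v = Sum.map inj₂ inj₂ (Real.#-cotrans {im z} {im w} p (im v))

  #-irrefl : ∀ {z w} → z ≈ w → ¬ (z # w)
  #-irrefl {z} {w} (p , q) = [ Real.#-irrefl {re z} {re w} p , Real.#-irrefl {im z} {im w} q ]′

  -- the inverse of a + bi is (a - bi) / (a² + b²)
  #⇒inverse : ∀ z w → z # w → ∃[ v ] (v * (z + - w) ≈ 1ℂ)
  #⇒inverse z w z#w = inverse (Real.#⇒inverse N 0ℝ (Real.norm#0 (re z) (re w) (im z) (im w) z#w))
    where
    d = z + - w
    a = re d
    b = im d
    N = a Real.* a Real.+ b Real.* b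
    inverse : ∃[ t ] (t Real.* (N Real.+ Real.- 0ℝ) Real.≈ 1ℝ) → ∃[ v ] (v * d ≈ 1ℂ)
    inverse (t , tN≈1) = v ,
      Real.≈-trans {re (v * d)} {t Real.* (N Real.+ Real.- 0ℝ)} {1ℝ}
        (≗⇒≈ (re (v * d)) (t Real.* (N Real.+ Real.- 0ℝ)) λ n → inverse-re (seq a n) (seq b n) (seq t n)) tN≈1 ,
      ≗⇒≈ (im (v * d)) 0ℝ λ n → inverse-im (seq a n) (seq b n) (seq t n)
      where
      v : ℂ
      v = (a Real.* t) +i (Real.- (b Real.* t))

  inverse⇒# : ∀ z w v → v * (z + - w) ≈ 1ℂ → z # w
  inverse⇒# z w v (re≈1 , _) = Sum.swap (Sum.map im-apart re-apart (Real.#-cotrans {p Real.+ Real.- q} {0ℝ} p-q#0 p))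
    where
    a = re z Real.+ Real.- re w
    b = im z Real.+ Real.- im w
    c = re v
    d = im v
    p = c Real.* a
    q = d Real.* b
    p-q = p Real.+ Real.- q
    p-q#0 : p-q Real.# 0ℝ
    p-q#0 = Real.inverse⇒# p-q 0ℝ 1ℝ
      (Real.≈-trans {1ℝ Real.* (p-q Real.+ Real.- 0ℝ)} {p-q} {1ℝ}
        (≗⇒≈ (1ℝ Real.* (p-q Real.+ Real.- 0ℝ)) p-q λ n → unit-sub (seq p-q n)) re≈1)
    re-apart : p Real.# 0ℝ → re z Real.# re w
    re-apart p#0 = apart (Real.#⇒inverse p 0ℝ p#0)
      where
      apart : ∃[ t ] (t Real.* (p Real.+ Real.- 0ℝ) Real.≈ 1ℝ) → re z Real.# re w
      apart (t , tp≈1) = Real.inverse⇒# (re z) (re w) (t Real.* c)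
        (Real.≈-trans {(t Real.* c) Real.* a} {t Real.* (p Real.+ Real.- 0ℝ)} {1ℝ}
          (≗⇒≈ ((t Real.* c) Real.* a) (t Real.* (p Real.+ Real.- 0ℝ))
            λ n → factor-re (seq t n) (seq c n) (seq a n)) tp≈1)
    im-apart : p-q Real.# p → im z Real.# im w
    im-apart p-q#p = apart (Real.#⇒inverse p-q p p-q#p)
      where
      apart : ∃[ t ] (t Real.* (p-q Real.+ Real.- p) Real.≈ 1ℝ) → im z Real.# im w
      apart (t , tq≈1) = Real.inverse⇒# (im z) (im w) (Real.- (t Real.* d))
        (Real.≈-trans {(Real.- (t Real.* d)) Real.* b} {t Real.* (p-q Real.+ Real.- p)} {1ℝ}
          (≗⇒≈ ((Real.- (t Real.* d)) Real.* b) (t Real.* (p-q Real.+ Real.- p))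
            λ n → factor-im (seq t n) (seq p n) (seq d n) (seq b n)) tq≈1)

  heytingField : HeytingField 0ℓ 0ℓ 0ℓ
  heytingField = record
    { Carrier = ℂ ; _≈_ = _≈_ ; _#_ = _#_ ; _+_ = _+_ ; _*_ = _*_ ; -_ = -_ ; 0# = 0ℂ ; 1# = 1ℂ
    ; isHeytingField = record
      { isHeytingCommutativeRing = record
        { isCommutativeRing = CommutativeRing.isCommutativeRing commutativeRing
        ; isApartnessRelation = record
          { irrefl  = λ {z} {w} → #-irrefl {z} {w}
          ; sym     = λ {z} {w} → Sum.map (Real.#-sym {re z} {re w}) (Real.#-sym {im z} {im w})
          ; cotrans = λ {z} {w} → #-cotrans {z} {w}
          }
        ; #⇒invertible = λ {z} {w} z#w → let v , vd≈1 = #⇒inverse z w z#w in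
            v , vd≈1 , ≈-trans {(z + - w) * v} {v * (z + - w)} {1ℂ} (*-comm (z + - w) v) vd≈1
        ; invertible⇒# = λ {z} {w} (v , vd≈1 , _) → inverse⇒# z w v vd≈1
        }
      ; tight = λ z w →
          (λ ¬z#w → Real.#-tight (re z) (re w) (λ p → ¬z#w (inj₁ p)) , Real.#-tight (im z) (im w) (λ p → ¬z#w (inj₂ p))) ,
          #-irrefl {z} {w}
      }
    }

------------------------------------------------------------------------
-- Binomial coefficients and harmonic numbers

module _ {c ℓ₁ ℓ₂} (K : HeytingField c ℓ₁ ℓ₂) where

  open HeytingField K using (Carrier; _#_; 0#; 1#; heytingCommutativeRing)
  open CommutativeRing (HeytingCommutativeRing.commutativeRing heytingCommutativeRing) using (semiring)
  open import Algebra.Definitions.RawSemiring (Semiring.rawSemiring semiring) using () renaming (_×_ to _·_)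

  CharacteristicZero : Set ℓ₂
  CharacteristicZero = ∀ n → .{{_ : ℕ.NonZero n}} → (n · 1#) # 0#

module FieldNotation {c ℓ₁ ℓ₂} (K : HeytingField c ℓ₁ ℓ₂) (char0 : CharacteristicZero K) where

  open HeytingField K hiding (zero; refl; sym; trans; _≈_; _+_; _*_; -_; _-_; 1#)
  open HeytingField K public using (_≈_; _+_; _*_; -_; _-_; 1#)
  private module K = HeytingField K
  open CommutativeRing (HeytingCommutativeRing.commutativeRing heytingCommutativeRing)
    using (semiring; ring; +-monoid; +-abelianGroup; +-commutativeMonoid)
  open import Algebra.Definitions.RawSemiring (Semiring.rawSemiring semiring) using (product)
    renaming (_×_ to _·_)
  open import Algebra.Definitions.RawSemiring (Semiring.rawSemiring semiring) public using (_^_)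
  open import Algebra.Properties.CommutativeMonoid.Sum +-commutativeMonoid public
    using (sum-syntax; sum⁺-syntax)
  open import Algebra.Properties.Monoid.Mult +-monoid using (×-homo-+)
  open import Algebra.Properties.Ring ring using (-‿involutive; -‿+-comm; -0#≈0#)
  open import Algebra.Properties.AbelianGroup +-abelianGroup using (xyx⁻¹≈y)
  open import Algebra.Apartness.Properties.HeytingCommutativeRing heytingCommutativeRing
    using (invertibleˡ⇒#; invertibleʳ⇒#; x-0≈x; 1#0; x#0y#0→xy#0; #-congʳ)
  import Relation.Binary.Reasoning.Setoid setoid as ≈-Reasoning

  fromℕ : ℕ → Carrier
  fromℕ n = n · 1#

  fromℤ : ℤ → Carrier
  fromℤ (+ n)    = fromℕ n
  fromℤ -[1+ n ] = - fromℕ (suc n)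

  infix 4 _∉[_,_]

  -- u is none of the integers a, a + 1, …, b
  _∉[_,_] : Carrier → ℤ → ℤ → Set ℓ₂
  u ∉[ a , b ] = ∀ j → a ℤ.≤ j → j ℤ.≤ b → u # fromℤ j

  infixl 7 _/_

  -- the denominator comes with a proof that it is nonzero
  _/_ : Carrier → ∃[ b ] (b # 0#) → Carrier
  a / (b , b#0) = a * proj₁ (#⇒invertible b#0)

  private
    ⁻¹#0 : ∀ {b} (b#0 : b # 0#) → proj₁ (#⇒invertible b#0) # 0#
    ⁻¹#0 {b} b#0 = let b⁻¹ , left , _ = #⇒invertible b#0 in
      invertibleʳ⇒# (b - 0# , K.trans (*-congʳ (x-0≈x b⁻¹)) left)

    /#0 : ∀ {a} b → a # 0# → (a / b) # 0#
    /#0 (b , b#0) a#0 = x#0y#0→xy#0 a#0 (⁻¹#0 b#0)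

    difference#0 : ∀ {a b} → a # b → a - b # 0#
    difference#0 {a} {b} a#b = let w , left , _ = #⇒invertible a#b in
      invertibleˡ⇒# (w , K.trans (*-congˡ (x-0≈x (a - b))) left)

    product#0 : ∀ {n} (f : Fin n → Carrier) → (∀ i → f i # 0#) → product f # 0#
    product#0 {zero}  f f#0 = 1#0
    product#0 {suc n} f f#0 = x#0y#0→xy#0 (f#0 zero) (product#0 (λ i → f (suc i)) (λ i → f#0 (suc i)))

    ^#0 : ∀ {a} ℓ → a # 0# → a ^ ℓ # 0#
    ^#0 zero    a#0 = 1#0
    ^#0 (suc ℓ) a#0 = x#0y#0→xy#0 a#0 (^#0 ℓ a#0)

  binom : Carrier → ℕ → Carrier
  binom u k = product {k} (λ i → u - fromℕ (toℕ i)) / (fromℕ (k !) , char0 (k !) {{k ℕ.!≢0}})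

  private
    binom#0 : ∀ u k → (∀ i → i ℕ.< k → u - fromℕ i # 0#) → binom u k # 0#
    binom#0 u k h = /#0 (fromℕ (k !) , char0 (k !) {{k ℕ.!≢0}})
      (product#0 (λ i → u - fromℕ (toℕ i)) (λ i → h (toℕ i) (Fin.toℕ<n i)))

    -n≤-[1+k] : ∀ {k n} → k ℕ.< n → ℤ.- (+ n) ℤ.≤ -[1+ k ]
    -n≤-[1+k] (s≤s k≤n) = ℤ.-≤- k≤n

  shift#0 : ∀ n u → u ∉[ ℤ.- (+ n) , -1ℤ ] → ∀ k → k ℕ.< n → u + fromℕ (suc k) # 0#
  shift#0 n u h k k<n = #-congʳ (+-congˡ (-‿involutive _))
    (difference#0 (h -[1+ k ] (-n≤-[1+k] k<n) (ℤ.-≤- z≤n)))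

  restrict : ∀ n k u → k ℕ.≤ n → u ∉[ ℤ.- (+ n) , -1ℤ ] → u ∉[ ℤ.- (+ k) , -1ℤ ]
  restrict n k u k≤n h j -k≤j = h j (ℤ.≤-trans (ℤ.neg-mono-≤ (ℤ.+≤+ k≤n)) -k≤j)

  -- the sum of 1 / (u + k)^ℓ over 1 ≤ k ≤ n, with i standing for k - 1
  H : (ℓ n : ℕ) (u : Carrier) → u ∉[ ℤ.- (+ n) , -1ℤ ] → Carrier
  H ℓ n u h = ∑[ i < n ] (1# / ((u + fromℕ (suc (toℕ i))) ^ ℓ , ^#0 ℓ (shift#0 n u h (toℕ i) (Fin.toℕ<n i))))

  2n#0 : ∀ n → 1 ℕ.≤ n → fromℕ (2 ℕ.* n) # 0#
  2n#0 (suc n) _ = char0 (2 ℕ.* suc n)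

  private
    fromℕ-+ : ∀ {m n} p q → m ℕ.+ n ≡ p ℕ.+ q → fromℕ m + fromℕ n ≈ fromℕ p + fromℕ q
    fromℕ-+ {m} {n} p q eq = begin
      fromℕ m + fromℕ n      ≈⟨ ×-homo-+ 1# m n ⟨
      fromℕ (m ℕ.+ n)        ≡⟨ cong fromℕ eq ⟩
      fromℕ (p ℕ.+ q)        ≈⟨ ×-homo-+ 1# p q ⟩
      fromℕ p + fromℕ q      ∎
      where open ≈-Reasoning

    cancel : ∀ u {a b c d} → a + b ≈ c + d → u - a + d - b ≈ u - c
    cancel u {a} {b} {c} {d} eq = begin
      u - a + d - b            ≈⟨ +-congʳ (+-assoc u (- a) d) ⟩
      u + (- a + d) - b        ≈⟨ +-assoc u (- a + d) (- b) ⟩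
      u + (- a + d - b)        ≈⟨ +-congˡ (+-congʳ (+-comm (- a) d)) ⟩
      u + (d - a - b)          ≈⟨ +-congˡ (+-assoc d (- a) (- b)) ⟩
      u + (d + (- a - b))      ≈⟨ +-congˡ (+-congˡ (-‿+-comm a b)) ⟩
      u + (d - (a + b))        ≈⟨ +-congˡ (+-congˡ (-‿cong eq)) ⟩
      u + (d - (c + d))        ≈⟨ +-congˡ (+-congˡ (-‿cong (+-comm c d))) ⟩
      u + (d - (d + c))        ≈⟨ +-congˡ (+-congˡ (-‿+-comm d c)) ⟨
      u + (d + (- d - c))      ≈⟨ +-congˡ (+-assoc d (- d) (- c)) ⟨
      u + (d - d - c)          ≈⟨ +-congˡ (+-congʳ (-‿inverseʳ d)) ⟩
      u + (0# - c)             ≈⟨ +-congˡ (+-identityˡ (- c)) ⟩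
      u - c                    ∎
      where open ≈-Reasoning

    below#0 : ∀ n y → y ∉[ ℤ.- (+ n) , + n ℤ.- 1ℤ ] → ∀ j → j ℕ.< n → y - fromℕ j # 0#
    below#0 (suc n) y h j (s≤s j≤n) = difference#0 (h (+ j) ℤ.-≤+ (ℤ.+≤+ j≤n))

  y+k#0 : ∀ n y k → 1 ℕ.≤ n → y ∉[ ℤ.- (+ n) , + n ℤ.- 1ℤ ] → k ℕ.≤ n → y + fromℕ k # 0#
  y+k#0 (suc n) y zero    n≥1 h _   = #-congʳ (+-congˡ -0#≈0#) (below#0 (suc n) y h 0 n≥1)
  y+k#0 (suc n) y (suc k) n≥1 h k<n = shift#0 (suc n) y (λ j -n≤j j≤-1 → h j -n≤j (ℤ.≤-trans j≤-1 ℤ.-≤+)) k k<n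

  binom[y-n+k]#0 : ∀ n y k → y ∉[ ℤ.- (+ n) , + n ℤ.- 1ℤ ] → k ℕ.≤ n →
                   binom (y - fromℕ n + fromℕ k) k # 0#
  binom[y-n+k]#0 n y k h k≤n = binom#0 (y - fromℕ n + fromℕ k) k λ i i<k →
    #-congʳ (K.sym (cancel y (fromℕ-+ {n} {i} ((n ℕ.∸ k) ℕ.+ i) k (index i)))) (below#0 n y h _ (bound i i<k))
    where
    open ≡-Reasoning
    index : ∀ i → n ℕ.+ i ≡ ((n ℕ.∸ k) ℕ.+ i) ℕ.+ k
    index i = begin
      n ℕ.+ i                      ≡⟨ cong (ℕ._+ i) (ℕ.m∸n+n≡m k≤n) ⟨
      ((n ℕ.∸ k) ℕ.+ k) ℕ.+ i      ≡⟨ ℕ.+-assoc (n ℕ.∸ k) k i ⟩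
      (n ℕ.∸ k) ℕ.+ (k ℕ.+ i)      ≡⟨ cong ((n ℕ.∸ k) ℕ.+_) (ℕ.+-comm k i) ⟩
      (n ℕ.∸ k) ℕ.+ (i ℕ.+ k)      ≡⟨ ℕ.+-assoc (n ℕ.∸ k) i k ⟨
      ((n ℕ.∸ k) ℕ.+ i) ℕ.+ k      ∎
    bound : ∀ i → i ℕ.< k → (n ℕ.∸ k) ℕ.+ i ℕ.< n
    bound i i<k = subst ((n ℕ.∸ k) ℕ.+ i ℕ.<_) (ℕ.m∸n+n≡m k≤n) (ℕ.+-monoʳ-< (n ℕ.∸ k) i<k)

  binom[x+n]#0 : ∀ n x → x ∉[ ℤ.- (+ n) , -1ℤ ] → binom (x + fromℕ n) n # 0#
  binom[x+n]#0 zero    x h = binom#0 (x + fromℕ 0) 0 λ _ ()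
  binom[x+n]#0 (suc n) x h = binom#0 (x + fromℕ (suc n)) (suc n) λ { i (s≤s i≤n) →
    #-congʳ (K.sym (x+n-i i (n ℕ.∸ i) (cong suc (sym (ℕ.m∸n+n≡m i≤n)))))
      (shift#0 (suc n) x h (n ℕ.∸ i) (s≤s (ℕ.m∸n≤m n i))) }
    where
    open ≈-Reasoning
    x+n-i : ∀ i j → suc n ≡ suc j ℕ.+ i → x + fromℕ (suc n) - fromℕ i ≈ x + fromℕ (suc j)
    x+n-i i j eq = begin
      x + fromℕ (suc n) - fromℕ i
        ≈⟨ +-assoc x _ _ ⟩
      x + (fromℕ (suc n) - fromℕ i)
        ≈⟨ +-congˡ (+-congʳ (K.trans (K.reflexive (cong fromℕ (trans eq (ℕ.+-comm (suc j) i)))) (×-homo-+ 1# i (suc j)))) ⟩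
      x + (fromℕ i + fromℕ (suc j) - fromℕ i)
        ≈⟨ +-congˡ (xyx⁻¹≈y (fromℕ i) (fromℕ (suc j))) ⟩
      x + fromℕ (suc j) ∎

  binom[y]#0 : ∀ n y → y ∉[ ℤ.- (+ n) , + n ℤ.- 1ℤ ] → binom y n # 0#
  binom[y]#0 n y h = binom#0 y n (below#0 n y h)

  binom[x+n]*binom[y]#0 : ∀ n x y → x ∉[ ℤ.- (+ n) , -1ℤ ] → y ∉[ ℤ.- (+ n) , + n ℤ.- 1ℤ ] →
                          binom (x + fromℕ n) n * binom y n # 0#
  binom[x+n]*binom[y]#0 n x y hx hy = x#0y#0→xy#0 (binom[x+n]#0 n x hx) (binom[y]#0 n y hy)

complex-char0 : CharacteristicZero Complex.heytingField
complex-char0 (suc n) = inj₁ (1ℚ , ℚ.positive⁻¹ 1ℚ , 0 , λ m _ → begin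
  1ℚ                                        ≤⟨ ℚ.≤-trans (ℚ.≤-reflexive (sym (ℚ.+-identityʳ 1ℚ))) (ℚ.+-monoʳ-≤ 1ℚ (p≥0 n m)) ⟩
  1ℚ ℚ.+ p n m                              ≡⟨ ℚ.0≤p⇒∣p∣≡p (ℚ.+-mono-≤ (ℚ.nonNegative⁻¹ 1ℚ) (p≥0 n m)) ⟨
  ∣ 1ℚ ℚ.+ p n m ∣                          ≡⟨ cong ∣_∣ (ℚ.+-identityʳ (1ℚ ℚ.+ p n m)) ⟨
  ∣ (1ℚ ℚ.+ p n m) ℚ.- 0ℚ ∣                 ∎)
  where
  open ℚ.≤-Reasoning
  open import Algebra.Definitions.RawSemiring (Semiring.rawSemiring (CommutativeRing.semiring Complex.commutativeRing))
    using () renaming (_×_ to _·_)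
  p : ℕ → ℕ → ℚ
  p k m = Real.seq (Complex.re (k · Complex.1ℂ)) m
  p≥0 : ∀ k m → 0ℚ ℚ.≤ p k m
  p≥0 zero    m = ℚ.≤-refl
  p≥0 (suc k) m = ℚ.+-mono-≤ (ℚ.nonNegative⁻¹ 1ℚ) (p≥0 k m)

-- Opaque because conversion checking would otherwise unfold complex
-- numbers down to sequences of rationals.
opaque
  ℂ-field : HeytingField 0ℓ 0ℓ 0ℓ
  ℂ-field = Complex.heytingField

  ℂ-char0 : CharacteristicZero ℂ-field
  ℂ-char0 = complex-char0

open HeytingField ℂ-field public using () renaming (Carrier to ℂ)
open FieldNotation ℂ-field ℂ-char0 public

{-# OPTIONS --safe #-}

-- The k-th coefficient of the sum is t k = (- n)ₖ (y)ₖ / (k! (y - n + 1)ₖ).  Its partial sums are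
-- again hypergeometric terms and the full sum vanishes, so summation by parts turns the left-hand
-- side into a combination of 1 / (x + j)³ for 1 ≤ j ≤ n.  Up to a constant, the coefficients of that
-- combination are the residues of the rational function g(x) = ∏ (x - y + i) / (x + i), taken over
-- 1 ≤ i ≤ n, so the sum is a multiple of g″(x).  Logarithmic differentiation expresses g″ through
-- harmonic numbers: g″ = g ((H_n(x-y) - H_n(x))² - (H_n⟨2⟩(x-y) - H_n⟨2⟩(x))).
-- Derivatives are coefficients of a product of truncated power series in ε.

module Submission where

open import Defs using (CharacteristicZero; module FieldNotation)
open import Algebra.Apartness.Bundles using (HeytingCommutativeRing; HeytingField)
open import Algebra.Bundles using (CommutativeMonoid; CommutativeRing; RawRing)
open import Algebra.Solver.Ring.AlmostCommutativeRing
  using (fromCommutativeRing; _-Raw-AlmostCommutative⟶_)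
open import Data.Fin.Base using (Fin; toℕ)
open import Data.Fin.Permutation using (reverse)
open import Data.Fin.Properties
  using (toℕ≤pred[n]; toℕ<n; toℕ-inject₁; toℕ-fromℕ; opposite-prop)
open import Data.Integer.Base as ℤ using (1ℤ; -1ℤ)
open import Data.Maybe.Base using (Maybe; just; nothing)
open import Data.Nat.Base as ℕ using (ℕ; zero; suc; s≤s; z≤n; _∸_; _<_; _!)
import Data.Nat.Properties as ℕ
open import Data.Product.Base using (∃-syntax; _×_; _,_; proj₁; proj₂)
open import Function.Base using (_∘_)
open import Relation.Binary.PropositionalEquality as ≡ using (_≡_)
open import Relation.Nullary using (Dec; yes; no; contradiction)

-- Integer coefficients for the ring solver.

module IntegerCoefficients {c ℓ} (R : CommutativeRing c ℓ) where

  open CommutativeRing R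
  open import Algebra.Properties.Ring ring
    using (-0#≈0#; -‿+-comm; x[y-z]≈xy-xz; [y-z]x≈yx-zx; ⁻¹-anti-homo‿-)
  open import Algebra.Properties.CommutativeSemigroup +-commutativeSemigroup using (interchange)
  open import Algebra.Properties.Semiring.Mult.TCOptimised semiring
    using (×-homo-+; ×1-homo-*) renaming (_×_ to _·_)
  open import Relation.Binary.Reasoning.Setoid setoid

  -- (a , b) stands for a - b.  The case b = 0 makes 0# and 1# definitionally the values of (0 , 0)
  -- and (1 , 0), so that solver goals can mention them literally.
  ⟦_⟧ : ℕ × ℕ → Carrier
  ⟦ a , zero ⟧  = a · 1#
  ⟦ a , suc b ⟧ = a · 1# - suc b · 1#

  ⟦⟧-difference : ∀ a b → ⟦ a , b ⟧ ≈ a · 1# - b · 1#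
  ⟦⟧-difference a zero    = sym (trans (+-congˡ -0#≈0#) (+-identityʳ _))
  ⟦⟧-difference a (suc b) = refl

  difference-+ : ∀ a b c d → (a + c) - (b + d) ≈ (a - b) + (c - d)
  difference-+ a b c d = begin
    (a + c) - (b + d)        ≈⟨ +-congˡ (-‿+-comm b d) ⟨
    (a + c) + (- b - d)      ≈⟨ interchange a c (- b) (- d) ⟩
    (a - b) + (c - d)        ∎

  difference-* : ∀ a b c d → (a * c + b * d) - (a * d + b * c) ≈ (a - b) * (c - d)
  difference-* a b c d = begin
    (a * c + b * d) - (a * d + b * c)      ≈⟨ difference-+ _ _ _ _ ⟩
    (a * c - a * d) + (b * d - b * c)      ≈⟨ +-congˡ (⁻¹-anti-homo‿- (b * c) (b * d)) ⟨
    (a * c - a * d) - (b * c - b * d)      ≈⟨ +-cong (x[y-z]≈xy-xz a c d) (-‿cong (x[y-z]≈xy-xz b c d)) ⟨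
    a * (c - d) - b * (c - d)              ≈⟨ [y-z]x≈yx-zx (c - d) a b ⟨
    (a - b) * (c - d)                      ∎

  ⟦⟧-cross : ∀ a b c d → a ℕ.+ d ≡ c ℕ.+ b → ⟦ a , b ⟧ ≈ ⟦ c , d ⟧
  ⟦⟧-cross a b c d eq = begin
    ⟦ a , b ⟧                                 ≈⟨ ⟦⟧-difference a b ⟩
    a · 1# - b · 1#                           ≈⟨ +-identityʳ _ ⟨
    (a · 1# - b · 1#) + 0#                    ≈⟨ +-congˡ (-‿inverseʳ (d · 1#)) ⟨
    (a · 1# - b · 1#) + (d · 1# - d · 1#)     ≈⟨ difference-+ _ _ _ _ ⟨
    (a · 1# + d · 1#) - (b · 1# + d · 1#)     ≈⟨ +-cong a+d (-‿cong (+-comm _ _)) ⟩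
    (c · 1# + b · 1#) - (d · 1# + b · 1#)     ≈⟨ difference-+ _ _ _ _ ⟩
    (c · 1# - d · 1#) + (b · 1# - b · 1#)     ≈⟨ +-congˡ (-‿inverseʳ (b · 1#)) ⟩
    (c · 1# - d · 1#) + 0#                    ≈⟨ +-identityʳ _ ⟩
    c · 1# - d · 1#                           ≈⟨ ⟦⟧-difference c d ⟨
    ⟦ c , d ⟧                                 ∎
    where
    a+d : a · 1# + d · 1# ≈ c · 1# + b · 1#
    a+d = trans (sym (×-homo-+ 1# a d)) (trans (reflexive (≡.cong (_· 1#) eq)) (×-homo-+ 1# c b))

  -- Cancellation leaves one pair for each integer, so normal forms with the same integer
  -- coefficients evaluate to the same term and `refl` closes the solver's goals.
  reduce : ℕ × ℕ → ℕ × ℕ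
  reduce (suc a , suc b) = reduce (a , b)
  reduce (a , b)         = a , b

  reduce-cross : ∀ a b → proj₁ (reduce (a , b)) ℕ.+ b ≡ a ℕ.+ proj₂ (reduce (a , b))
  reduce-cross zero    b       = ≡.refl
  reduce-cross (suc a) zero    = ≡.refl
  reduce-cross (suc a) (suc b) = ≡.trans (ℕ.+-suc _ b) (≡.cong suc (reduce-cross a b))

  ⟦⟧-reduce : ∀ a b → ⟦ reduce (a , b) ⟧ ≈ a · 1# - b · 1#
  ⟦⟧-reduce a b = trans (⟦⟧-cross _ _ a b (reduce-cross a b)) (⟦⟧-difference a b)

  coefficients : RawRing _ _
  coefficients = record
    { Carrier = ℕ × ℕ
    ; _≈_     = _≡_
    ; _+_     = λ (a , b) (c , d) → reduce (a ℕ.+ c , b ℕ.+ d)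
    ; _*_     = λ (a , b) (c , d) → reduce (a ℕ.* c ℕ.+ b ℕ.* d , a ℕ.* d ℕ.+ b ℕ.* c)
    ; -_      = λ (a , b) → b , a
    ; 0#      = 0 , 0
    ; 1#      = 1 , 0
    }

  private
    homo-+* : ∀ a b c d → (a ℕ.* b ℕ.+ c ℕ.* d) · 1# ≈ a · 1# * b · 1# + c · 1# * d · 1#
    homo-+* a b c d = trans (×-homo-+ 1# (a ℕ.* b) (c ℕ.* d)) (+-cong (×1-homo-* a b) (×1-homo-* c d))

  homomorphism : coefficients -Raw-AlmostCommutative⟶ fromCommutativeRing R
  homomorphism = record
    { ⟦_⟧    = ⟦_⟧
    ; +-homo = λ (a , b) (c , d) → begin
        ⟦ reduce (a ℕ.+ c , b ℕ.+ d) ⟧               ≈⟨ ⟦⟧-reduce (a ℕ.+ c) (b ℕ.+ d) ⟩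
        (a ℕ.+ c) · 1# - (b ℕ.+ d) · 1#              ≈⟨ +-cong (×-homo-+ 1# a c) (-‿cong (×-homo-+ 1# b d)) ⟩
        (a · 1# + c · 1#) - (b · 1# + d · 1#)        ≈⟨ difference-+ _ _ _ _ ⟩
        (a · 1# - b · 1#) + (c · 1# - d · 1#)        ≈⟨ +-cong (⟦⟧-difference a b) (⟦⟧-difference c d) ⟨
        ⟦ a , b ⟧ + ⟦ c , d ⟧                        ∎
    ; *-homo = λ (a , b) (c , d) → begin
        ⟦ reduce (a ℕ.* c ℕ.+ b ℕ.* d , a ℕ.* d ℕ.+ b ℕ.* c) ⟧             ≈⟨ ⟦⟧-reduce (a ℕ.* c ℕ.+ b ℕ.* d) (a ℕ.* d ℕ.+ b ℕ.* c) ⟩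
        (a ℕ.* c ℕ.+ b ℕ.* d) · 1# - (a ℕ.* d ℕ.+ b ℕ.* c) · 1#            ≈⟨ +-cong (homo-+* a c b d) (-‿cong (homo-+* a d b c)) ⟩
        (a · 1# * c · 1# + b · 1# * d · 1#) - (a · 1# * d · 1# + b · 1# * c · 1#)  ≈⟨ difference-* _ _ _ _ ⟩
        (a · 1# - b · 1#) * (c · 1# - d · 1#)                              ≈⟨ *-cong (⟦⟧-difference a b) (⟦⟧-difference c d) ⟨
        ⟦ a , b ⟧ * ⟦ c , d ⟧                                              ∎
    ; -‿homo = λ (a , b) → begin
        ⟦ b , a ⟧                ≈⟨ ⟦⟧-difference b a ⟩
        b · 1# - a · 1#          ≈⟨ ⁻¹-anti-homo‿- (a · 1#) (b · 1#) ⟨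
        - (a · 1# - b · 1#)      ≈⟨ -‿cong (⟦⟧-difference a b) ⟨
        - ⟦ a , b ⟧              ∎
    ; 0-homo = refl
    ; 1-homo = refl
    }

  _coeff≟_ : ∀ p q → Maybe (⟦ p ⟧ ≈ ⟦ q ⟧)
  (a , b) coeff≟ (c , d) with (a ℕ.+ d) ℕ.≟ (c ℕ.+ b)
  ... | yes eq = just (⟦⟧-cross a b c d eq)
  ... | no  _  = nothing

  open import Algebra.Solver.Ring coefficients (fromCommutativeRing R) homomorphism _coeff≟_ public
    using (Polynomial; solve; con; _:+_; _:*_; _:-_; :-_; _:=_)

  :0 :1 : ∀ {n} → Polynomial n
  :0 = con (0 , 0)
  :1 = con (1 , 0)

-- Sums and products over the indices below a bound.

module FoldsBelow {c ℓ} (M : CommutativeMonoid c ℓ) where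

  open CommutativeMonoid M
  open import Algebra.Properties.CommutativeMonoid.Sum M public
    using (sum; sum-init-last; sum-cong-≋; sum-cong-≗; sum-permute)

  -- The family lives on all of ℕ, so the bound can vary without reindexing, while the fold stays
  -- definitionally a fold over `Fin n`.
  fold< : ℕ → (ℕ → Carrier) → Carrier
  fold< n f = sum {n} (f ∘ toℕ)

  fold<-last : ∀ n f → fold< (suc n) f ≈ fold< n f ∙ f n
  fold<-last n f = trans (sum-init-last (f ∘ toℕ)) (∙-cong
    (reflexive (sum-cong-≗ λ (i : Fin n) → ≡.cong f (toℕ-inject₁ i)))
    (reflexive (≡.cong f (toℕ-fromℕ n))))

  fold<-cong : ∀ {n f g} → (∀ i → i < n → f i ≈ g i) → fold< n f ≈ fold< n g
  fold<-cong {n} f≈g = sum-cong-≋ λ (i : Fin n) → f≈g (toℕ i) (toℕ<n i)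

  fold<-reverse : ∀ n f → fold< n f ≈ fold< n (λ i → f (n ∸ suc i))
  fold<-reverse n f = trans (sum-permute (f ∘ toℕ) (reverse {n}))
    (reflexive (sum-cong-≗ λ (i : Fin n) → ≡.cong f (opposite-prop i)))

-- Reciprocals and summation by parts in a commutative ring.

module Residues {c ℓ} (R : CommutativeRing c ℓ) where

  open CommutativeRing R
  open import Algebra.Properties.Monoid.Mult +-monoid using (×-homo-+) renaming (_×_ to _·_)
  open import Algebra.Properties.Semiring.Exp semiring using (_^_; ^-congˡ)
  open import Algebra.Properties.Semiring.Sum semiring using (∑-distrib-+; *-distribˡ-sum)
  open import Relation.Binary.Reasoning.Setoid setoid
  open IntegerCoefficients R using (solve; _:+_; _:*_; _:-_; :-_; _:=_; :0; :1)
  open FoldsBelow +-commutativeMonoid public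
    renaming (fold< to ∑<; fold<-last to ∑<-last; fold<-cong to ∑<-cong)
    using ()
  open FoldsBelow *-commutativeMonoid public
    renaming (fold< to ∏<; fold<-last to ∏<-last; fold<-cong to ∏<-cong; fold<-reverse to ∏<-reverse)
    using ()

  ι : ℕ → Carrier
  ι n = n · 1#

  ι-+ : ∀ m n {k} → k ≡ m ℕ.+ n → ι k ≈ ι m + ι n
  ι-+ m n ≡.refl = ×-homo-+ 1# m n

  -- Here `u i` plays the part of 1 / (x + i + 1). Reciprocals given as data let the calculation run
  -- without a division operation.
  Inverts : ℕ → Carrier → (ℕ → Carrier) → Set _
  Inverts n x u = ∀ i → i < n → (x + ι (suc i)) * u i ≈ 1#

  shorten : ∀ {n x u} → Inverts (suc n) x u → Inverts n x u
  shorten inv i i<n = inv i (ℕ.m<n⇒m<1+n i<n)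

  -- Turns a hypothesis e ≈ f and its multiplier into a goal for the ring solver.
  modulo : ∀ {a b e f} k → e ≈ f → a ≈ b + k * (e - f) → a ≈ b
  modulo {a} {b} {e} {f} k e≈f a≈b+ = begin
    a                    ≈⟨ a≈b+ ⟩
    b + k * (e - f)      ≈⟨ +-congˡ (*-congˡ (trans (+-congʳ e≈f) (-‿inverseʳ f))) ⟩
    b + k * 0#           ≈⟨ trans (+-congˡ (zeroʳ k)) (+-identityʳ b) ⟩
    b                    ∎

  ∑<-linear₂ : ∀ n p q {f} a b → (∀ i → i < n → f i ≈ p * a i + q * b i) →
               ∑< n f ≈ p * ∑< n a + q * ∑< n b
  ∑<-linear₂ n p q {f} a b eq = begin
    ∑< n f                                           ≈⟨ ∑<-cong eq ⟩
    ∑< n (λ i → p * a i + q * b i)                   ≈⟨ ∑-distrib-+ {n} _ _ ⟩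
    ∑< n (λ i → p * a i) + ∑< n (λ i → q * b i)      ≈⟨ +-cong (*-distribˡ-sum {n} p _) (*-distribˡ-sum {n} q _) ⟨
    p * ∑< n a + q * ∑< n b                          ∎

  ∑<-linear₃ : ∀ n p q r {f} a b c → (∀ i → i < n → f i ≈ p * a i + q * b i + r * c i) →
               ∑< n f ≈ p * ∑< n a + q * ∑< n b + r * ∑< n c
  ∑<-linear₃ n p q r a b c eq = trans
    (∑<-linear₂ n 1# r (λ i → p * a i + q * b i) c λ i i<n → trans (eq i i<n) (+-congʳ (sym (*-identityˡ _))))
    (+-congʳ (trans (*-identityˡ _) (∑<-linear₂ n p q a b λ i _ → refl)))

  -- By the hypotheses `s` lists the partial sums of `t`. In the double sum `c i` has the
  -- coefficient t (i + 1) + ⋯ + t n, which is `s n - s i`.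
  abel-summation : ∀ n (s t c : ℕ → Carrier) → t 0 ≈ s 0 → (∀ k → k < n → s k + t (suc k) ≈ s (suc k)) →
                   ∑< (suc n) (λ k → t k * ∑< k c) ≈ s n * ∑< n c - ∑< n (λ k → s k * c k)
  abel-summation zero s t c t₀≈s₀ _ = begin
    t 0 * 0# + 0#      ≈⟨ trans (+-congʳ (zeroʳ _)) (+-identityˡ _) ⟩
    0#                 ≈⟨ -‿inverseʳ 0# ⟨
    0# - 0#            ≈⟨ +-congʳ (zeroʳ _) ⟨
    s 0 * 0# - 0#      ∎
  abel-summation (suc n) s t c t₀≈s₀ step = begin
    ∑< (suc (suc n)) (λ k → t k * ∑< k c)
      ≈⟨ ∑<-last (suc n) (λ k → t k * ∑< k c) ⟩
    ∑< (suc n) (λ k → t k * ∑< k c) + t (suc n) * ∑< (suc n) c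
      ≈⟨ +-cong (abel-summation n s t c t₀≈s₀ λ k k<n → step k (ℕ.m<n⇒m<1+n k<n)) (*-congˡ (∑<-last n c)) ⟩
    (s n * A - B) + t (suc n) * (A + c n)
      ≈⟨ modulo (A + c n) (step n ℕ.≤-refl)
           (solve 6 (λ s s′ t A B c → (s :* A :- B) :+ t :* (A :+ c) :=
             (s′ :* (A :+ c) :- (B :+ s :* c)) :+ (A :+ c) :* (s :+ t :- s′))
             refl (s n) (s (suc n)) (t (suc n)) A B (c n)) ⟩
    s (suc n) * (A + c n) - (B + s n * c n)
      ≈⟨ +-cong (*-congˡ (∑<-last n c)) (-‿cong (∑<-last n λ k → s k * c k)) ⟨
    s (suc n) * ∑< (suc n) c - ∑< (suc n) (λ k → s k * c k) ∎
    where
    A = ∑< n c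
    B = ∑< n (λ k → s k * c k)

  -- Binomial coefficients as products.

  module _ (ρ : ℕ → Carrier) (ι*ρ : ∀ m → ι (suc m) * ρ m ≈ 1#) where

    -- The binomial coefficient of z + k over k.
    rising : Carrier → ℕ → Carrier
    rising z zero    = 1#
    rising z (suc k) = rising z k * ((z + ι (suc k)) * ρ k)

    rising-cong : ∀ {z z′} k → z ≈ z′ → rising z k ≈ rising z′ k
    rising-cong zero    z≈z′ = refl
    rising-cong (suc k) z≈z′ = *-cong (rising-cong k z≈z′) (*-congʳ (+-congʳ z≈z′))

    rising-shift : ∀ z k → rising (z - 1#) (suc k) ≈ rising z k * (z * ρ k)
    rising-shift z zero =
      solve 2 (λ z r → :1 :* ((z :- :1 :+ (:1 :+ :0)) :* r) := :1 :* (z :* r)) refl z (ρ 0)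
    rising-shift z (suc k) = trans (*-congʳ (rising-shift z k))
      (solve 5 (λ z i r r′ C → (C :* (z :* r)) :* ((z :- :1 :+ (:1 :+ (:1 :+ i))) :* r′) :=
                  (C :* ((z :+ (:1 :+ i)) :* r)) :* (z :* r′))
         refl z (ι k) (ρ k) (ρ (suc k)) (rising z k))

    -- Written as 1 + z / i, the factors (z + i) / i have the shape required by `partial-fractions`.
    rising-product : ∀ z k → rising z k ≈ ∏< k (λ i → 1# + z * ρ i)
    rising-product z zero    = refl
    rising-product z (suc k) = trans
      (*-cong (rising-product z k) (modulo 1# (ι*ρ k)
        (solve 3 (λ z i r → (z :+ i) :* r := (:1 :+ z :* r) :+ :1 :* (i :* r :- :1))
           refl z (ι (suc k)) (ρ k))))
      (sym (∏<-last k λ i → 1# + z * ρ i))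

    -- The last factor is zero. Hence the boundary term of the summation by parts will vanish.
    rising[-n]-n : ∀ n → rising (- ι (suc n)) (suc n) ≈ 0#
    rising[-n]-n n = trans (*-congˡ (trans (*-congʳ (-‿inverseˡ (ι (suc n)))) (zeroˡ (ρ n)))) (zeroʳ _)

    -- Residues and partial fractions.

    module _ (y : Carrier) where

      -- The residue at x = - (j + 1) of the product of (x - y + i) / (x + i) over 1 ≤ i ≤ n is - y * weight n j.
      weight : ℕ → ℕ → Carrier
      weight n j = rising y j * rising (- y) (n ∸ suc j)

      -- The new factor (x - y + n + 1) / (x + n + 1) multiplies the residue at an old pole by its
      -- value there, which at x = - (j + 1) is 1 - y / (n - j).
      weight-suc : ∀ n j → j < n → weight (suc n) j ≈ weight n j * (1# - y * ρ (n ∸ suc j))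
      weight-suc n j j<n = begin
        rising y j * rising (- y) (n ∸ j)            ≡⟨ ≡.cong (λ d → rising y j * rising (- y) d) (ℕ.+-∸-assoc 1 j<n) ⟩
        rising y j * (rising (- y) d * ((- y + ι (suc d)) * ρ d))
          ≈⟨ modulo (rising y j * rising (- y) d) (ι*ρ d)
               (solve 5 (λ y a b i r → a :* (b :* ((:- y :+ i) :* r)) :=
                   (a :* b) :* (:1 :- y :* r) :+ (a :* b) :* (i :* r :- :1))
                 refl y (rising y j) (rising (- y) d) (ι (suc d)) (ρ d)) ⟩
        weight n j * (1# - y * ρ d) ∎
        where d = n ∸ suc j

      weight-last : ∀ n → weight (suc n) n ≈ rising y n
      weight-last n = trans (reflexive (≡.cong (λ d → rising y n * rising (- y) d) (ℕ.n∸n≡0 n))) (*-identityʳ _)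

      -- For `u j` = 1 / (x + j + 1) and mₖ the moment of order k, the rational function satisfies g
      -- = 1 - y m₁, g′ = y m₂ and g″ = - 2 y m₃.
      moment : ℕ → (ℕ → Carrier) → ℕ → Carrier
      moment k u n = ∑< n (λ j → weight n j * u j ^ k)

      reciprocal-moment : ℕ → Carrier
      reciprocal-moment n = ∑< n (λ j → weight n j * ρ (n ∸ suc j))

      -- 1/(x+j+1) - 1/(x+n+1) is (n - j) times the product of the two fractions.
      reciprocal-difference : ∀ {n x u} → Inverts (suc n) x u → ∀ j → j < n →
                              ρ (n ∸ suc j) * u j ≈ u j * u n + ρ (n ∸ suc j) * u n
      reciprocal-difference {n} {x} {u} inv j j<n =
        modulo (ρ d * u n) (inv j (ℕ.m<n⇒m<1+n j<n))
        (modulo (u j * u n) (ι*ρ d)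
        (modulo (ρ d * u j * u n) (ι-+ (suc d) (suc j) index)
        (modulo (- (ρ d * u j)) (inv n ℕ.≤-refl)
          (solve 7 (λ r a b i j x n → r :* a :=
              a :* b :+ r :* b :+ r :* b :* ((x :+ j) :* a :- :1) :+ a :* b :* (i :* r :- :1)
                :+ r :* a :* b :* (n :- (i :+ j)) :+ (:- (r :* a)) :* ((x :+ n) :* b :- :1))
            refl (ρ d) (u j) (u n) (ι (suc d)) (ι (suc j)) x (ι (suc n))))))
        where
        d = n ∸ suc j
        index : suc n ≡ suc d ℕ.+ suc j
        index = ≡.cong suc (≡.sym (ℕ.m∸n+n≡m j<n))

      -- `weight-suc` brings in `ρ (n ∸ suc j)`, and `reciprocal-difference` then lowers the power
      -- of `u j` by one. The changes in the weights add up to the change of the moment of order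
      -- `k`, the new pole included.
      moment-suc : ∀ {n x u} → Inverts (suc n) x u → ∀ k →
                   moment (suc k) u (suc n) ≈
                   (1# - y * u n) * moment (suc k) u n + u n * (moment k u (suc n) - moment k u n)
      moment-suc {n} {x} {u} inv k = begin
        moment (suc k) u (suc n)
          ≈⟨ ∑<-last n (λ j → weight (suc n) j * u j ^ suc k) ⟩
        ∑< n (λ j → weight (suc n) j * u j ^ suc k) + W * (u n * u n ^ k)
          ≈⟨ +-congʳ (∑<-linear₃ n (1# - y * u n) (u n) (- u n) _ (λ j → weight (suc n) j * u j ^ k) _ term) ⟩
        (1# - y * u n) * moment (suc k) u n + u n * T + - u n * moment k u n + W * (u n * u n ^ k)
          ≈⟨ solve 7 (λ q b S T S₀ W p → q :* S :+ b :* T :+ (:- b) :* S₀ :+ W :* (b :* p) :=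
                        q :* S :+ b :* ((T :+ W :* p) :- S₀))
               refl (1# - y * u n) (u n) (moment (suc k) u n) T (moment k u n) W (u n ^ k) ⟩
        (1# - y * u n) * moment (suc k) u n + u n * (T + W * u n ^ k - moment k u n)
          ≈⟨ +-congˡ (*-congˡ (+-congʳ (∑<-last n (λ j → weight (suc n) j * u j ^ k)))) ⟨
        (1# - y * u n) * moment (suc k) u n + u n * (moment k u (suc n) - moment k u n) ∎
        where
        W = weight (suc n) n
        T = ∑< n (λ j → weight (suc n) j * u j ^ k)
        term : ∀ j → j < n → weight (suc n) j * u j ^ suc k ≈
               (1# - y * u n) * (weight n j * u j ^ suc k) + u n * (weight (suc n) j * u j ^ k)
                 + - u n * (weight n j * u j ^ k)
        term j j<n =
          modulo (u j ^ suc k - u n * u j ^ k) (weight-suc n j j<n)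
          (modulo (- (y * weight n j * u j ^ k)) (reciprocal-difference inv j j<n)
            (solve 7 (λ y w w′ r a b p → w′ :* (a :* p) :=
                (:1 :- y :* b) :* (w :* (a :* p)) :+ b :* (w′ :* p) :+ (:- b) :* (w :* p)
                  :+ (a :* p :- b :* p) :* (w′ :- w :* (:1 :- y :* r))
                  :+ (:- (y :* w :* p)) :* (r :* a :- (a :* b :+ r :* b)))
              refl y (weight n j) (weight (suc n) j) (ρ (n ∸ suc j)) (u j) (u n) (u j ^ k)))

      mutual

        -- Since g = 1 - n y / x + ⋯ at infinity, n weights add up to n. Algebraically, the old
        -- weights lose y times `reciprocal-moment n` in total, and the new weight exceeds 1 by the
        -- same amount.
        moment-zero-suc : ∀ u n → moment 0 u (suc n) ≈ moment 0 u n + 1#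
        moment-zero-suc u n = begin
          moment 0 u (suc n)
            ≈⟨ ∑<-last n (λ j → weight (suc n) j * 1#) ⟩
          ∑< n (λ j → weight (suc n) j * 1#) + weight (suc n) n * 1#
            ≈⟨ +-cong (∑<-linear₂ n 1# (- y) (λ j → weight n j * 1#) (λ j → weight n j * ρ (n ∸ suc j)) λ j j<n →
                        trans (*-congʳ (weight-suc n j j<n))
                          (solve 3 (λ w y r → w :* (:1 :- y :* r) :* :1 := :1 :* (w :* :1) :+ (:- y) :* (w :* r))
                            refl (weight n j) y (ρ (n ∸ suc j))))
                      (*-congʳ (trans (weight-last n) (rising-expansion n))) ⟩
          (1# * moment 0 u n + - y * reciprocal-moment n) + (1# + y * reciprocal-moment n) * 1#
            ≈⟨ solve 3 (λ S y R → :1 :* S :+ (:- y) :* R :+ (:1 :+ y :* R) :* :1 := S :+ :1)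
                 refl (moment 0 u n) y (reciprocal-moment n) ⟩
          moment 0 u n + 1# ∎

        -- The induction is joint: the step to n + 1 needs the sum of the weights, hence
        -- `rising-expansion n`, which is this expansion with n factors at another point.
        partial-fractions : ∀ n {x u} → Inverts n x u → ∏< n (λ i → 1# - y * u i) ≈ 1# - y * moment 1 u n
        partial-fractions zero inv = solve 1 (λ y → :1 := :1 :- y :* :0) refl y
        partial-fractions (suc n) {x} {u} inv = begin
          ∏< (suc n) (λ i → 1# - y * u i)
            ≈⟨ ∏<-last n (λ i → 1# - y * u i) ⟩
          ∏< n (λ i → 1# - y * u i) * (1# - y * u n)
            ≈⟨ *-congʳ (partial-fractions n (shorten inv)) ⟩
          (1# - y * moment 1 u n) * (1# - y * u n)
            ≈⟨ solve 4 (λ y b S S₀ → (:1 :- y :* S) :* (:1 :- y :* b) :=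
                          :1 :- y :* ((:1 :- y :* b) :* S :+ b :* ((S₀ :+ :1) :- S₀)))
                 refl y (u n) (moment 1 u n) (moment 0 u n) ⟩
          1# - y * ((1# - y * u n) * moment 1 u n + u n * (moment 0 u n + 1# - moment 0 u n))
            ≈⟨ +-congˡ (-‿cong (*-congˡ (+-congˡ (*-congˡ (+-congʳ (moment-zero-suc u n)))))) ⟨
          1# - y * ((1# - y * u n) * moment 1 u n + u n * (moment 0 u (suc n) - moment 0 u n))
            ≈⟨ +-congˡ (-‿cong (*-congˡ (moment-suc inv 0))) ⟨
          1# - y * moment 1 u (suc n) ∎

        -- This is the partial fraction expansion at x = - (n + 1).
        rising-expansion : ∀ n → rising y n ≈ 1# + y * reciprocal-moment n
        rising-expansion n = begin
          rising y n                                  ≈⟨ rising-product y n ⟩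
          -- Reversed, the factor at `i` contains 1 / (n - i), the negative of the reciprocal of x +
          -- i + 1 at x = - (n + 1).
          ∏< n (λ i → 1# + y * ρ i)                   ≈⟨ ∏<-reverse n (λ i → 1# + y * ρ i) ⟩
          ∏< n (λ i → 1# + y * ρ (n ∸ suc i))         ≈⟨ ∏<-cong {n} (λ i _ → +-congˡ (y*-- (ρ (n ∸ suc i)))) ⟩
          ∏< n (λ i → 1# - y * - ρ (n ∸ suc i))       ≈⟨ partial-fractions n { - ι (suc n)} inv ⟩
          1# - y * moment 1 (λ i → - ρ (n ∸ suc i)) n ≈⟨ +-congˡ (-‿cong (*-congˡ moment-negate)) ⟩
          1# - y * (0# * reciprocal-moment n + - 1# * reciprocal-moment n)
            ≈⟨ solve 2 (λ y R → :1 :- y :* (:0 :* R :+ (:- :1) :* R) := :1 :+ y :* R) refl y (reciprocal-moment n) ⟩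
          1# + y * reciprocal-moment n                ∎
          where
          y*-- : ∀ r → y * r ≈ - (y * - r)
          y*-- r = solve 2 (λ y r → y :* r := :- (y :* (:- r))) refl y r
          moment-negate : moment 1 (λ i → - ρ (n ∸ suc i)) n ≈ 0# * reciprocal-moment n + - 1# * reciprocal-moment n
          moment-negate = ∑<-linear₂ n 0# (- 1#) _ _ λ j _ →
            solve 2 (λ w r → w :* ((:- r) :* :1) := :0 :* (w :* r) :+ (:- :1) :* (w :* r))
              refl (weight n j) (ρ (n ∸ suc j))
          inv : Inverts n (- ι (suc n)) (λ i → - ρ (n ∸ suc i))
          inv i i<n =
            modulo (ρ d) (ι-+ (suc d) (suc i) (≡.cong suc (≡.sym (ℕ.m∸n+n≡m i<n))))
            (modulo 1# (ι*ρ d)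
              (solve 4 (λ N a b r → (:- N :+ b) :* (:- r) := :1 :+ r :* (N :- (a :+ b)) :+ :1 :* (a :* r :- :1))
                refl (ι (suc n)) (ι (suc d)) (ι (suc i)) (ρ d)))
            where d = n ∸ suc i

      -- Taylor coefficients of the product.

      -- value, slope and curvature are the coefficients of 1, ε and ε² in the product of 1 - y / (x + i + ε).
      module _ (u : ℕ → Carrier) where

        value slope curvature : ℕ → Carrier
        value n = ∏< n (λ i → 1# - y * u i)
        slope zero        = 0#
        slope (suc n)     = slope n * (1# - y * u n) + value n * (y * u n ^ 2)
        curvature zero    = 0#
        curvature (suc n) = curvature n * (1# - y * u n) + slope n * (y * u n ^ 2) - value n * (y * u n ^ 3)

        -- This is the coefficient of ε in the shifted partial fraction expansion. `moment-suc` at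
        -- orders 0 and 1 reproduces the recursion of `slope`.
        slope-moment : ∀ n {x} → Inverts n x u → slope n ≈ y * moment 2 u n
        slope-moment zero    inv = sym (zeroʳ y)
        slope-moment (suc n) inv = begin
          slope n * (1# - y * u n) + value n * (y * u n ^ 2)
            ≈⟨ +-cong (*-congʳ (slope-moment n (shorten inv))) (*-congʳ (partial-fractions n (shorten inv))) ⟩
          y * S₂ * (1# - y * u n) + (1# - y * S₁) * (y * u n ^ 2)
            ≈⟨ modulo (- (y * u n)) (moment-suc inv 0)
              (modulo (- (y * u n * u n)) (moment-zero-suc u n)
                (solve 7 (λ y b S₀ S₁ S₂ M₀ M₁ →
                    y :* S₂ :* (:1 :- y :* b) :+ (:1 :- y :* S₁) :* (y :* (b :* (b :* :1))) :=
                    y :* ((:1 :- y :* b) :* S₂ :+ b :* (M₁ :- S₁))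
                      :+ (:- (y :* b)) :* (M₁ :- ((:1 :- y :* b) :* S₁ :+ b :* (M₀ :- S₀)))
                      :+ (:- (y :* b :* b)) :* (M₀ :- (S₀ :+ :1)))
                  refl y (u n) (moment 0 u n) S₁ S₂ (moment 0 u (suc n)) (moment 1 u (suc n)))) ⟩
          y * ((1# - y * u n) * S₂ + u n * (moment 1 u (suc n) - S₁))
            ≈⟨ *-congˡ (moment-suc inv 1) ⟨
          y * moment 2 u (suc n) ∎
          where
          S₁ = moment 1 u n
          S₂ = moment 2 u n

        curvature-moment : ∀ n {x} → Inverts n x u → curvature n ≈ - (y * moment 3 u n)
        curvature-moment zero    inv = solve 1 (λ y → :0 := :- (y :* :0)) refl y
        curvature-moment (suc n) inv = begin
          curvature n * (1# - y * u n) + slope n * (y * u n ^ 2) - value n * (y * u n ^ 3)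
            ≈⟨ +-cong (+-cong (*-congʳ (curvature-moment n (shorten inv))) refl) refl ⟩
          - (y * S₃) * (1# - y * u n) + slope n * (y * u n ^ 2) - value n * (y * u n ^ 3)
            -- `slope-moment` at both `n` and `suc n` supplies the second moments that `moment-suc`
            -- needs at order 2, and the terms in `value n` cancel.
            ≈⟨ modulo (u n) (slope-moment n (shorten inv))
              (modulo (- u n) (slope-moment (suc n) inv)
                (solve 7 (λ y b v s S₂ S₃ M₂ →
                    (:- (y :* S₃)) :* (:1 :- y :* b) :+ s :* (y :* (b :* (b :* :1))) :- v :* (y :* (b :* (b :* (b :* :1)))) :=
                    :- (y :* ((:1 :- y :* b) :* S₃ :+ b :* (M₂ :- S₂)))
                      :+ b :* (s :- y :* S₂)
                      :+ (:- b) :* ((s :* (:1 :- y :* b) :+ v :* (y :* (b :* (b :* :1)))) :- y :* M₂))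
                  refl y (u n) (value n) (slope n) S₂ S₃ (moment 2 u (suc n)))) ⟩
          - (y * ((1# - y * u n) * S₃ + u n * (moment 2 u (suc n) - S₂)))
            ≈⟨ -‿cong (*-congˡ (moment-suc inv 2)) ⟨
          - (y * moment 3 u (suc n)) ∎
          where
          S₂ = moment 2 u n
          S₃ = moment 3 u n

        -- Logarithmic differentiation.

        module _ {x : Carrier} {v : ℕ → Carrier} where

          -- The factor 1 - y / (x + n + 1) is the quotient of `u n` by `v n`.
          factor*v : ∀ n → Inverts (suc n) x u → Inverts (suc n) (x - y) v → (1# - y * u n) * v n ≈ u n
          factor*v n inv-u inv-v =
            modulo (- v n) (inv-u n ℕ.≤-refl)
            (modulo (u n) (inv-v n ℕ.≤-refl)
              (solve 5 (λ x y i a b → (:1 :- y :* a) :* b :=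
                  a :+ (:- b) :* ((x :+ i) :* a :- :1) :+ a :* ((x :- y :+ i) :* b :- :1))
                refl x y (ι (suc n)) (u n) (v n)))

          rising-quotient : ∀ n → Inverts n x u → rising (x - y) n ≈ rising x n * value n
          rising-quotient zero    inv = sym (*-identityˡ 1#)
          rising-quotient (suc n) inv = begin
            rising (x - y) n * ((x - y + ι (suc n)) * ρ n)
              ≈⟨ *-congʳ (rising-quotient n (shorten inv)) ⟩
            rising x n * value n * ((x - y + ι (suc n)) * ρ n)
              ≈⟨ modulo (rising x n * value n * y * ρ n) (inv n ℕ.≤-refl)
                   (solve 7 (λ X V x y i a r → X :* V :* ((x :- y :+ i) :* r) :=
                       X :* ((x :+ i) :* r) :* (V :* (:1 :- y :* a))
                         :+ X :* V :* y :* r :* ((x :+ i) :* a :- :1))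
                     refl (rising x n) (value n) x y (ι (suc n)) (u n) (ρ n)) ⟩
            rising x n * ((x + ι (suc n)) * ρ n) * (value n * (1# - y * u n))
              ≈⟨ *-congˡ (∏<-last n (λ i → 1# - y * u i)) ⟨
            rising x (suc n) * value (suc n) ∎

          -- At `ℓ` = 1 this is the logarithmic derivative h of the product, and h′ is the negative
          -- of the gap at `ℓ` = 2.
          harmonic-gap : ℕ → ℕ → Carrier
          harmonic-gap ℓ n = ∑< n (λ i → v i ^ ℓ) - ∑< n (λ i → u i ^ ℓ)

          harmonic-gap-suc : ∀ ℓ n → harmonic-gap ℓ (suc n) ≈ harmonic-gap ℓ n + (v n ^ ℓ - u n ^ ℓ)
          harmonic-gap-suc ℓ n = trans
            (+-cong (∑<-last n (λ i → v i ^ ℓ)) (-‿cong (∑<-last n (λ i → u i ^ ℓ))))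
            (solve 4 (λ A a B b → (A :+ a) :- (B :+ b) := (A :- B) :+ (a :- b)) refl
              (∑< n (λ i → v i ^ ℓ)) (v n ^ ℓ) (∑< n (λ i → u i ^ ℓ)) (u n ^ ℓ))

          slope-logarithmic : ∀ n → Inverts n x u → Inverts n (x - y) v → slope n ≈ value n * harmonic-gap 1 n
          slope-logarithmic zero    inv-u inv-v = solve 0 (:0 := :1 :* (:0 :- :0)) refl
          slope-logarithmic (suc n) inv-u inv-v = begin
            slope n * (1# - y * u n) + value n * (y * u n ^ 2)
              ≈⟨ modulo (1# - y * u n) (slope-logarithmic n (shorten inv-u) (shorten inv-v))
                (modulo (- value n) (factor*v n inv-u inv-v)
                  (solve 6 (λ y a b V s h → s :* (:1 :- y :* a) :+ V :* (y :* (a :* (a :* :1))) :=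
                      V :* (:1 :- y :* a) :* (h :+ (b :* :1 :- a :* :1))
                        :+ (:1 :- y :* a) :* (s :- V :* h)
                        :+ (:- V) :* ((:1 :- y :* a) :* b :- a))
                    refl y (u n) (v n) (value n) (slope n) (harmonic-gap 1 n))) ⟩
            value n * (1# - y * u n) * (harmonic-gap 1 n + (v n ^ 1 - u n ^ 1))
              ≈⟨ *-cong (∏<-last n (λ i → 1# - y * u i)) (harmonic-gap-suc 1 n) ⟨
            value (suc n) * harmonic-gap 1 (suc n) ∎

          -- From g′ = g h follows g″ = g (h² + h′). As `curvature` is g″ / 2, its double appears
          -- here.
          curvature-logarithmic : ∀ n → Inverts n x u → Inverts n (x - y) v →
            curvature n + curvature n ≈ value n * (harmonic-gap 1 n ^ 2 - harmonic-gap 2 n)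
          curvature-logarithmic zero    inv-u inv-v =
            solve 0 (:0 :+ :0 := :1 :* ((:0 :- :0) :* ((:0 :- :0) :* :1) :- (:0 :- :0))) refl
          curvature-logarithmic (suc n) inv-u inv-v = begin
            curvature (suc n) + curvature (suc n)
              ≈⟨ modulo (1# - y * u n) (curvature-logarithmic n (shorten inv-u) (shorten inv-v))
                (modulo (y * u n * u n + y * u n * u n) (slope-logarithmic n (shorten inv-u) (shorten inv-v))
                (modulo (- (value n + value n) * (h - u n)) (factor*v n inv-u inv-v)
                  (solve 8 (λ y a b V s c h k →
                      let q = :1 :- y :* a
                          c′ = c :* q :+ s :* (y :* (a :* (a :* :1))) :- V :* (y :* (a :* (a :* (a :* :1))))
                          h′ = h :+ (b :* :1 :- a :* :1)
                      in c′ :+ c′ :=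
                      V :* q :* (h′ :* (h′ :* :1) :- (k :+ (b :* (b :* :1) :- a :* (a :* :1))))
                        :+ q :* (c :+ c :- V :* (h :* (h :* :1) :- k))
                        :+ (y :* a :* a :+ y :* a :* a) :* (s :- V :* h)
                        :+ (:- (V :+ V)) :* (h :- a) :* (q :* b :- a))
                    refl y (u n) (v n) (value n) (slope n) (curvature n) h k))) ⟩
            value n * (1# - y * u n) * ((h + (v n ^ 1 - u n ^ 1)) ^ 2 - (k + (v n ^ 2 - u n ^ 2)))
              ≈⟨ *-cong (∏<-last n (λ i → 1# - y * u i))
                   (+-cong (^-congˡ 2 (harmonic-gap-suc 1 n)) (-‿cong (harmonic-gap-suc 2 n))) ⟨
            value (suc n) * (harmonic-gap 1 (suc n) ^ 2 - harmonic-gap 2 (suc n)) ∎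
            where
            h = harmonic-gap 1 n
            k = harmonic-gap 2 n

      -- Reflection of rising products.

      rising-exchange : ∀ m j → j ℕ.≤ m →
        rising (- y) m * rising (- ι (suc m)) j ≈ rising (- y) (m ∸ j) * rising (y - ι (suc m)) j
      rising-exchange m zero    _   = refl
      rising-exchange m (suc j) j<m =
        -- As N = D + J, the factor (- y + D) / D split off from `rising (- y) m` equals (y - N + J)
        -- / (- N + J).
        modulo ((- N + J) * ρ j) exchange
        (modulo (Q * B * ρ j * (y - D)) (ι*ρ d)
        (modulo (Q * B * ρ j * (1# - (- y + D) * ρ d)) (ι-+ (suc d) (suc j) (≡.cong suc (≡.sym (ℕ.m∸n+n≡m j<m))))
          (solve 10 (λ M A Q B y D J N r r′ → M :* (A :* ((:- N :+ J) :* r)) :=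
              Q :* (B :* ((y :- N :+ J) :* r))
                :+ (:- N :+ J) :* r :* (M :* A :- Q :* ((:- y :+ D) :* r′) :* B)
                :+ Q :* B :* r :* (y :- D) :* (D :* r′ :- :1)
                :+ Q :* B :* r :* (:1 :- (:- y :+ D) :* r′) :* (N :- (D :+ J)))
            refl (rising (- y) m) (rising (- N) j) Q B y D J N (ρ j) (ρ d))))
        where
        d = m ∸ suc j
        Q = rising (- y) d
        B = rising (y - ι (suc m)) j
        N = ι (suc m)
        J = ι (suc j)
        D = ι (suc d)
        exchange : rising (- y) m * rising (- N) j ≈ Q * ((- y + D) * ρ d) * B
        exchange = trans (rising-exchange m j (ℕ.<⇒≤ j<m))
          (reflexive (≡.cong (λ d → rising (- y) d * B) (ℕ.+-∸-assoc 1 j<m)))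

    -- The left-hand side is the binomial coefficient of - 1 over m.
    rising-sign : ∀ m → rising (- ι (suc m)) m ≈ (- 1#) ^ m
    rising-sign zero    = refl
    rising-sign (suc m) = begin
      rising (- ι (suc (suc m))) (suc m)
        ≈⟨ rising-cong (suc m) (solve 1 (λ i → :- (:1 :+ i) := :- i :- :1) refl (ι (suc m))) ⟩
      rising (- ι (suc m) - 1#) (suc m)             ≈⟨ rising-shift (- ι (suc m)) m ⟩
      rising (- ι (suc m)) m * (- ι (suc m) * ρ m)  ≈⟨ *-congʳ (rising-sign m) ⟩
      (- 1#) ^ m * (- ι (suc m) * ρ m)
        ≈⟨ modulo (- (- 1#) ^ m) (ι*ρ m)
             (solve 3 (λ s i r → s :* (:- i :* r) := :- :1 :* s :+ (:- s) :* (i :* r :- :1))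
               refl ((- 1#) ^ m) (ι (suc m)) (ρ m)) ⟩
      (- 1#) ^ suc m ∎

    -- Partial sums of the hypergeometric coefficients.

    module _ (y : Carrier) (m : ℕ) (e f u : ℕ → Carrier)
             (inv-e : ∀ k → k ℕ.≤ suc m → rising (y - ι (suc m)) k * e k ≈ 1#)
             (inv-f : ∀ k → k ℕ.≤ suc m → (y + ι k) * f k ≈ 1#)
             where

      private
        N = ι (suc m)

      -- The first factor of `summand` is the signed binomial coefficient of `N` over k after upper
      -- negation; `e` and `f` supply the reciprocals of the two denominators.
      summand partial-sum : ℕ → Carrier
      summand k     = rising (- N - 1#) k * (rising y k * e k) * (y * f k)
      partial-sum k = rising (- N) k * (rising y k * e k)

      e-suc : ∀ k → k ℕ.≤ m → e k ≈ e (suc k) * ((y - N + ι (suc k)) * ρ k)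
      e-suc k k≤m =
        modulo (- e k) (inv-e (suc k) (s≤s k≤m))
        (modulo (e (suc k) * g) (inv-e k (ℕ.m≤n⇒m≤1+n k≤m))
          (solve 4 (λ B e e′ g → e := e′ :* g :+ (:- e) :* (B :* g :* e′ :- :1) :+ e′ :* g :* (B :* e :- :1))
            refl (rising (y - N) k) (e k) (e (suc k)) g))
        where
        g = (y - N + ι (suc k)) * ρ k

      -- Gosper summation: the hypergeometric series with parameters a = - N, b = y and c = a + b + 1.
      telescope-zero : summand 0 ≈ partial-sum 0
      telescope-zero = modulo (e 0) (inv-f 0 z≤n)
        (solve 3 (λ y e f → :1 :* (:1 :* e) :* (y :* f) := :1 :* (:1 :* e) :+ e :* ((y :+ :0) :* f :- :1))
          refl y (e 0) (f 0))

      telescope-suc : ∀ k → k < suc m → partial-sum k + summand (suc k) ≈ partial-sum (suc k)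
      telescope-suc k (s≤s k≤m) = begin
        partial-sum k + summand (suc k)
          ≈⟨ +-congˡ (*-congʳ (*-congʳ (rising-shift (- N) k))) ⟩
        A * (Y * e k) + A * (- N * ρ k) * (Y * ((y + J) * ρ k) * e′) * (y * f (suc k))
          -- Without common factors the identity reads J (y - N + J) - N y = (J - N) (y + J).
          ≈⟨ modulo (A * Y) (e-suc k k≤m)
            (modulo (- (A * Y * e′ * ρ k * N * ρ k * y)) (inv-f (suc k) (s≤s k≤m))
            (modulo (- (A * Y * e′ * ρ k * (y - N + J))) (ι*ρ k)
              (solve 9 (λ A Y e e′ f r y J N →
                  A :* (Y :* e) :+ A :* (:- N :* r) :* (Y :* ((y :+ J) :* r) :* e′) :* (y :* f) :=
                  A :* ((:- N :+ J) :* r) :* (Y :* ((y :+ J) :* r) :* e′)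
                    :+ A :* Y :* (e :- e′ :* ((y :- N :+ J) :* r))
                    :+ (:- (A :* Y :* e′ :* r :* N :* r :* y)) :* ((y :+ J) :* f :- :1)
                    :+ (:- (A :* Y :* e′ :* r :* (y :- N :+ J))) :* (J :* r :- :1))
                refl A Y (e k) e′ (f (suc k)) (ρ k) y J N))) ⟩
        partial-sum (suc k) ∎
        where
        A = rising (- N) k
        Y = rising y k
        J = ι (suc k)
        e′ = e (suc k)

      -- `rising-exchange` turns `rising (- N) k` into `rising (y - N) k`, which `e k` cancels. So
      -- the partial sums are residues up to a constant.
      partial-sum-weight : ∀ k → k < suc m → rising (- y) m * partial-sum k ≈ weight y (suc m) k
      partial-sum-weight k (s≤s k≤m) =
        modulo (Y * e k) (rising-exchange y m k k≤m)
        (modulo (Y * Q) (inv-e k (ℕ.m≤n⇒m≤1+n k≤m))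
          (solve 6 (λ M A Y e Q B → M :* (A :* (Y :* e)) :=
              Y :* Q :+ Y :* e :* (M :* A :- Q :* B) :+ Y :* Q :* (B :* e :- :1))
            refl (rising (- y) m) (rising (- N) k) Y (e k) Q (rising (y - N) k)))
        where
        Y = rising y k
        Q = rising (- y) (m ∸ k)

      summation : ∀ {x} → Inverts (suc m) x u →
        y * rising (- y) m * ∑< (suc (suc m)) (λ k → summand k * ∑< k (λ i → u i ^ 3)) ≈ curvature y u (suc m)
      summation inv-u = begin
        y * M * ∑< (suc (suc m)) (λ k → summand k * ∑< k cube)
          ≈⟨ *-congˡ (abel-summation (suc m) partial-sum summand cube telescope-zero telescope-suc) ⟩
        y * M * (partial-sum (suc m) * ∑< (suc m) cube - S)
          -- The boundary term contains the vanishing `rising (- N) (suc m)`. The summand `0# * S`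
          -- is padding that fits the shape of `∑<-linear₂`.
          ≈⟨ modulo (y * M * rising y (suc m) * e (suc m) * ∑< (suc m) cube) (rising[-n]-n m)
               (solve 7 (λ y M A Y e H S → y :* M :* (A :* (Y :* e) :* H :- S) :=
                   :- (y :* (M :* S :+ :0 :* S)) :+ y :* M :* Y :* e :* H :* (A :- :0))
                 refl y M (rising (- N) (suc m)) (rising y (suc m)) (e (suc m)) (∑< (suc m) cube) S) ⟩
        - (y * (M * S + 0# * S))
          ≈⟨ -‿cong (*-congˡ (∑<-linear₂ (suc m) M 0# (λ k → partial-sum k * cube k) (λ k → partial-sum k * cube k)
               λ k k<n → modulo (- cube k) (partial-sum-weight k k<n)
                 (solve 4 (λ M s w c → w :* c := M :* (s :* c) :+ :0 :* (s :* c) :+ (:- c) :* (M :* s :- w))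
                   refl M (partial-sum k) (weight y (suc m) k) (cube k)))) ⟨
        - (y * moment y 3 u (suc m))
          ≈⟨ curvature-moment y u (suc m) inv-u ⟨
        curvature y u (suc m) ∎
        where
        M = rising (- y) m
        cube = λ i → u i ^ 3
        S = ∑< (suc m) (λ k → partial-sum k * cube k)

    -- Constants and assembly.

    rising-normalisation : ∀ y m → ι (suc m) * rising (y - ι (suc m)) (suc m) ≈ y * rising (- y) m * (- 1#) ^ m
    rising-normalisation y m =
      -- The case j = m of `rising-exchange` meets `rising-sign`. This trades the constant y * M of
      -- `summation` for n times the binomial coefficient of y over n, up to sign, where n = m + 1.
      modulo (- y) exchange
      (modulo (y * M) (rising-sign m)
      (modulo (y * B) (ι*ρ m)
        (solve 7 (λ y N r M A B s → N :* (B :* ((y :- N :+ N) :* r)) :=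
            y :* M :* s :+ (:- y) :* (M :* A :- :1 :* B) :+ y :* M :* (A :- s) :+ y :* B :* (N :* r :- :1))
          refl y (ι (suc m)) (ρ m) M (rising (- ι (suc m)) m) B ((- 1#) ^ m))))
      where
      M = rising (- y) m
      B = rising (y - ι (suc m)) m
      exchange : M * rising (- ι (suc m)) m ≈ 1# * B
      exchange = trans (rising-exchange y m m ℕ.≤-refl)
        (reflexive (≡.cong (λ d → rising (- y) d * B) (ℕ.n∸n≡0 m)))

    -- Multiplied by s i X D, the double of k = y M L becomes 2 N B L i X D, which the last two
    -- hypotheses reduce to L. The bracket is opposite in sign to that of the first hypothesis,
    -- whence the factor `- 1#`.
    assemble : ∀ {s i N X V B D M y L k g₁ g₂} →
      k + k ≈ V * (g₁ ^ 2 - g₂) → y * M * L ≈ k → N * B ≈ y * M * s → X * B * D ≈ 1# → (N + N) * i ≈ 1# →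
      (- 1# * s) * i * (X * V * D) * (g₂ - g₁ ^ 2) ≈ L
    assemble {s} {i} {N} {X} {V} {B} {D} {M} {y} {L} {k} {g₁} {g₂} 2c≈ yML≈c NB≈ XBD≈1 2Ni≈1 = begin
      (- 1# * s) * i * (X * V * D) * (g₂ - g₁ ^ 2)
        ≈⟨ modulo (- (s * i * X * D)) 2c≈
             (solve 8 (λ s i X V D k g₁ g₂ → (:- :1 :* s) :* i :* (X :* V :* D) :* (g₂ :- g₁ :* (g₁ :* :1)) :=
                 s :* i :* X :* D :* (k :+ k)
                   :+ (:- (s :* i :* X :* D)) :* (k :+ k :- V :* (g₁ :* (g₁ :* :1) :- g₂)))
               refl s i X V D k g₁ g₂) ⟩
      s * i * X * D * (k + k)
        ≈⟨ *-congˡ (+-cong yML≈c yML≈c) ⟨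
      s * i * X * D * (y * M * L + y * M * L)
        ≈⟨ modulo (- (i * X * D * L + i * X * D * L)) NB≈
             (solve 9 (λ s i X D y M L N B → s :* i :* X :* D :* (y :* M :* L :+ y :* M :* L) :=
                 i :* X :* D :* L :* (N :* B :+ N :* B)
                   :+ (:- (i :* X :* D :* L :+ i :* X :* D :* L)) :* (N :* B :- y :* M :* s))
               refl s i X D y M L N B) ⟩
      i * X * D * L * (N * B + N * B)
        ≈⟨ modulo (i * N * L + i * N * L) XBD≈1 (modulo L 2Ni≈1
             (solve 6 (λ i X D L N B → i :* X :* D :* L :* (N :* B :+ N :* B) :=
                 L :+ (i :* N :* L :+ i :* N :* L) :* (X :* B :* D :- :1) :+ L :* ((N :+ N) :* i :- :1))
               refl i X D L N B)) ⟩
      L ∎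

    transformation : ∀ (x y : Carrier) m (e f u v : ℕ → Carrier) {i D}
      (inv-e : ∀ k → k ℕ.≤ suc m → rising (y - ι (suc m)) k * e k ≈ 1#)
      (inv-f : ∀ k → k ℕ.≤ suc m → (y + ι k) * f k ≈ 1#) →
      Inverts (suc m) x u → Inverts (suc m) (x - y) v →
      rising x (suc m) * rising (y - ι (suc m)) (suc m) * D ≈ 1# → (ι (suc m) + ι (suc m)) * i ≈ 1# →
      ∑< (suc (suc m)) (λ k → summand y m e f u inv-e inv-f k * ∑< k (λ j → u j ^ 3)) ≈
      ((- 1#) ^ suc m * i) * (rising (x - y) (suc m) * D)
        * (harmonic-gap y u {x} {v} 2 (suc m) - harmonic-gap y u {x} {v} 1 (suc m) ^ 2)
    transformation x y m e f u v {i} {D} inv-e inv-f inv-u inv-v denominator doubled = begin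
      L
        ≈⟨ assemble {(- 1#) ^ m} {i} {ι (suc m)} {rising x (suc m)} {value y u (suc m)} {B} {D}
             {rising (- y) m} {y} {L} {curvature y u (suc m)} {gap 1} {gap 2}
             (curvature-logarithmic y u (suc m) inv-u inv-v)
             (summation y m e f u inv-e inv-f inv-u)
             (rising-normalisation y m) denominator doubled ⟨
      (- 1# * (- 1#) ^ m) * i * (rising x (suc m) * value y u (suc m) * D) * (gap 2 - gap 1 ^ 2)
        ≈⟨ *-congʳ (*-congˡ (*-congʳ (rising-quotient y u {x} {v} (suc m) inv-u))) ⟨
      ((- 1#) ^ suc m * i) * (rising (x - y) (suc m) * D) * (gap 2 - gap 1 ^ 2) ∎
      where
      B = rising (y - ι (suc m)) (suc m)
      gap = λ ℓ → harmonic-gap y u {x} {v} ℓ (suc m)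
      L = ∑< (suc (suc m)) (λ k → summand y m e f u inv-e inv-f k * ∑< k (λ j → u j ^ 3))

-- Binomial coefficients and harmonic numbers in characteristic zero.

module Evaluation {c ℓ₁ ℓ₂} (K : HeytingField c ℓ₁ ℓ₂) (char0 : CharacteristicZero K) where

  open HeytingField K using (_#_; #⇒invertible; heytingCommutativeRing)
  open CommutativeRing (HeytingCommutativeRing.commutativeRing heytingCommutativeRing)
  open FieldNotation K char0 using (_∉[_,_]; _/_; binom; H)
  open import Algebra.Apartness.Properties.HeytingCommutativeRing heytingCommutativeRing using (x-0≈x)
  open import Algebra.Properties.Semiring.Exp semiring using (_^_)
  open import Algebra.Properties.Semiring.Mult semiring using (×1-homo-*)
  open import Relation.Binary.Reasoning.Setoid setoid
  open Residues (HeytingCommutativeRing.commutativeRing heytingCommutativeRing)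
  open IntegerCoefficients (HeytingCommutativeRing.commutativeRing heytingCommutativeRing)
    using (solve; _:+_; _:*_; _:-_; :-_; _:=_; :1)

  inverse : ∀ {b} → b # 0# → Carrier
  inverse b#0 = proj₁ (#⇒invertible b#0)

  *-inverse : ∀ {b} (b#0 : b # 0#) → b * inverse b#0 ≈ 1#
  *-inverse {b} b#0 = trans (*-congʳ (sym (x-0≈x b))) (proj₂ (proj₂ (#⇒invertible b#0)))

  -- This frees the reciprocals in the statement from the apartness proofs that form them.
  inverse-unique : ∀ {a b b′} → a * b ≈ 1# → a * b′ ≈ 1# → b ≈ b′
  inverse-unique {a} {b} {b′} ab≈1 ab′≈1 = modulo b′ ab≈1 (modulo (- b) ab′≈1
    (solve 3 (λ a b b′ → b := b′ :+ b′ :* (a :* b :- :1) :+ (:- b) :* (a :* b′ :- :1)) refl a b b′))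

  /-inverse : ∀ {a b d} (b#0 : b # 0#) → b * d ≈ 1# → a / (b , b#0) ≈ a * d
  /-inverse b#0 bd≈1 = *-congˡ (inverse-unique (*-inverse b#0) bd≈1)

  -- The function has to be total, so it takes the arbitrary value `0#` outside the range, where no
  -- property is claimed.
  inverses : ∀ n (a : ℕ → Carrier) → (∀ i → i < n → a i # 0#) → ∃[ u ] (∀ i → i < n → a i * u i ≈ 1#)
  inverses n a a#0 = (λ i → choose i (i ℕ.<? n)) , λ i i<n → choose-inverse i i<n (i ℕ.<? n)
    where
    choose : ∀ i → Dec (i < n) → Carrier
    choose i (yes i<n) = inverse (a#0 i i<n)
    choose i (no  _)   = 0#
    choose-inverse : ∀ i → i < n → (i<?n : Dec (i < n)) → a i * choose i i<?n ≈ 1#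
    choose-inverse i _   (yes i<n) = *-inverse (a#0 i i<n)
    choose-inverse i i<n (no  i≮n) = contradiction i<n i≮n

  ρ : ℕ → Carrier
  ρ m = inverse (char0 (suc m))

  ι*ρ : ∀ m → ι (suc m) * ρ m ≈ 1#
  ι*ρ m = *-inverse (char0 (suc m))

  1/_! : ℕ → Carrier
  1/ k ! = inverse (char0 (k !) {{k ℕ.!≢0}})

  1/!-zero : 1/ 0 ! ≈ 1#
  1/!-zero = inverse-unique (*-inverse (char0 1)) (trans (*-identityʳ _) (+-identityʳ 1#))

  1/!-suc : ∀ k → 1/ suc k ! ≈ 1/ k ! * ρ k
  1/!-suc k = inverse-unique (*-inverse (char0 (suc k !) {{suc k ℕ.!≢0}})) (begin
    ι (suc k ℕ.* k !) * (1/ k ! * ρ k)          ≈⟨ *-congʳ (×1-homo-* (suc k) (k !)) ⟩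
    ι (suc k) * ι (k !) * (1/ k ! * ρ k)
      ≈⟨ modulo (ι (k !) * 1/ k !) (ι*ρ k) (modulo 1# (*-inverse (char0 (k !) {{k ℕ.!≢0}}))
           (solve 4 (λ i f g r → i :* f :* (g :* r) := :1 :+ f :* g :* (i :* r :- :1) :+ :1 :* (f :* g :- :1))
             refl (ι (suc k)) (ι (k !)) (1/ k !) (ρ k))) ⟩
    1#                                          ∎)

  binom-cong : ∀ {u u′} k → u ≈ u′ → binom u k ≈ binom u′ k
  binom-cong {u} {u′} k u≈u′ = *-congʳ (∏<-cong {k} {λ i → u - ι i} {λ i → u′ - ι i} λ i _ → +-congʳ u≈u′)

  -- Read backwards, the factors z + k - i of the binomial coefficient are z + 1, ..., z + k.
  binom-rising : ∀ z k → binom (z + ι k) k ≈ rising ρ ι*ρ z k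
  binom-rising z k = begin
    ∏< k (λ i → z + ι k - ι i) * 1/ k !
      ≈⟨ *-congʳ (∏<-reverse k (λ i → z + ι k - ι i)) ⟩
    ∏< k (λ i → z + ι k - ι (k ∸ suc i)) * 1/ k !
      ≈⟨ *-congʳ (∏<-cong {k} λ i i<k → modulo 1# (ι-+ (k ∸ suc i) (suc i) (≡.sym (ℕ.m∸n+n≡m i<k)))
           (solve 4 (λ z k a b → z :+ k :- a := z :+ b :+ :1 :* (k :- (a :+ b)))
             refl z (ι k) (ι (k ∸ suc i)) (ι (suc i)))) ⟩
    ∏< k (λ i → z + ι (suc i)) * 1/ k !
      ≈⟨ rising-∏ k ⟨
    rising ρ ι*ρ z k ∎
    where
    rising-∏ : ∀ k → rising ρ ι*ρ z k ≈ ∏< k (λ i → z + ι (suc i)) * 1/ k !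
    rising-∏ zero    = sym (trans (*-identityˡ _) 1/!-zero)
    rising-∏ (suc k) = begin
      rising ρ ι*ρ z k * ((z + ι (suc k)) * ρ k)
        ≈⟨ *-congʳ (rising-∏ k) ⟩
      ∏< k (λ i → z + ι (suc i)) * 1/ k ! * ((z + ι (suc k)) * ρ k)
        ≈⟨ solve 4 (λ p f t r → p :* f :* (t :* r) := p :* t :* (f :* r)) refl
             (∏< k (λ i → z + ι (suc i))) (1/ k !) (z + ι (suc k)) (ρ k) ⟩
      ∏< k (λ i → z + ι (suc i)) * (z + ι (suc k)) * (1/ k ! * ρ k)
        ≈⟨ *-cong (∏<-last k (λ i → z + ι (suc i))) (1/!-suc k) ⟨
      ∏< (suc k) (λ i → z + ι (suc i)) * 1/ suc k ! ∎

  -- Upper negation: each factor z - i changes its sign and becomes (- z - 1) + (i + 1).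
  signed-binom : ∀ z k → (- 1#) ^ k * binom z k ≈ rising ρ ι*ρ (- z - 1#) k
  signed-binom z zero    = trans (*-identityˡ _) (trans (*-identityˡ _) 1/!-zero)
  signed-binom z (suc k) = begin
    - 1# * (- 1#) ^ k * (∏< (suc k) (λ i → z - ι i) * 1/ suc k !)
      ≈⟨ *-congˡ (*-cong (∏<-last k (λ i → z - ι i)) (1/!-suc k)) ⟩
    - 1# * (- 1#) ^ k * (∏< k (λ i → z - ι i) * (z - ι k) * (1/ k ! * ρ k))
      ≈⟨ solve 6 (λ s p z i f r → (:- :1) :* s :* (p :* (z :- i) :* (f :* r)) :=
                    s :* (p :* f) :* ((:- z :- :1 :+ (:1 :+ i)) :* r)) refl
           ((- 1#) ^ k) (∏< k (λ i → z - ι i)) z (ι k) (1/ k !) (ρ k) ⟩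
    (- 1#) ^ k * binom z k * ((- z - 1# + ι (suc k)) * ρ k)
      ≈⟨ *-congʳ (signed-binom z k) ⟩
    rising ρ ι*ρ (- z - 1#) (suc k) ∎

  ^-inverse : ∀ {a b} ℓ → a * b ≈ 1# → a ^ ℓ * b ^ ℓ ≈ 1#
  ^-inverse         zero    ab≈1 = *-identityˡ 1#
  ^-inverse {a} {b} (suc ℓ) ab≈1 = modulo (a ^ ℓ * b ^ ℓ) ab≈1 (modulo 1# (^-inverse ℓ ab≈1)
    (solve 4 (λ a b p q → a :* p :* (b :* q) := :1 :+ p :* q :* (a :* b :- :1) :+ :1 :* (p :* q :- :1))
      refl a b (a ^ ℓ) (b ^ ℓ)))

  H-sum : ∀ ℓ n {x} (h : x ∉[ ℤ.- (ℤ.+ n) , -1ℤ ]) u → Inverts n x u → H ℓ n x h ≈ ∑< n (λ i → u i ^ ℓ)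
  H-sum ℓ n {x} h u inv = sum-cong-≋ λ (i : Fin n) →
    trans (*-identityˡ _) (inverse-unique (*-inverse _) (^-inverse ℓ (inv (toℕ i) (toℕ<n i))))
    where open FoldsBelow +-commutativeMonoid using (sum-cong-≋)

-- The identity over the complex numbers.

open import Defs

ℂ-ring : CommutativeRing _ _
ℂ-ring = HeytingCommutativeRing.commutativeRing (HeytingField.heytingCommutativeRing ℂ-field)

open Evaluation ℂ-field ℂ-char0
open Residues ℂ-ring

H-power-sum : ∀ ℓ k n x (k≤n : k ℕ.≤ n) (hx : x ∉[ ℤ.- (ℤ.+ n) , -1ℤ ]) u → Inverts n x u →
              H ℓ k x (restrict n k x k≤n hx) ≈ ∑< k (λ i → u i ^ ℓ)
H-power-sum ℓ k n x k≤n hx u inv =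
  H-sum ℓ k (restrict n k x k≤n hx) u λ i i<k → inv i (ℕ.<-≤-trans i<k k≤n)

H-gap : ∀ ℓ n x y hx hxy u v → Inverts n x u → Inverts n (x - y) v →
        H ℓ n (x - y) hxy - H ℓ n x hx ≈ harmonic-gap ρ ι*ρ y u {x} {v} ℓ n
H-gap ℓ n x y hx hxy u v inv-u inv-v = +-cong (H-sum ℓ n hxy v inv-v) (-‿cong (H-sum ℓ n hx u inv-u))
  where open CommutativeRing ℂ-ring using (+-cong; -‿cong)

-- The statement is spelled out, since unfolding a named summand would make the conversion checker
-- compare the nonvanishing proofs inside H, which takes time exponential in ℓ.
term-summand : ∀ m x y (n≥1 : 1 ℕ.≤ suc m)
    (hx  : x ∉[ ℤ.- (ℤ.+ suc m) , -1ℤ ])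
    (hy  : y ∉[ ℤ.- (ℤ.+ suc m) , ℤ.+ suc m ℤ.- 1ℤ ])
    (e f u : ℕ → ℂ)
    (inv-e : ∀ k → k ℕ.≤ suc m → rising ρ ι*ρ (y - fromℕ (suc m)) k * e k ≈ 1#)
    (inv-f : ∀ k → k ℕ.≤ suc m → (y + fromℕ k) * f k ≈ 1#) →
    Inverts (suc m) x u → ∀ (k : Fin (suc (suc m))) →
      (- 1#) ^ toℕ k * binom (fromℕ (suc m)) (toℕ k)
        * (binom (y + fromℕ (toℕ k)) (toℕ k)
           / (binom (y - fromℕ (suc m) + fromℕ (toℕ k)) (toℕ k)
             , binom[y-n+k]#0 (suc m) y (toℕ k) hy (toℕ≤pred[n] k)))
        * (y / (y + fromℕ (toℕ k) , y+k#0 (suc m) y (toℕ k) n≥1 hy (toℕ≤pred[n] k)))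
        * H 3 (toℕ k) x (restrict (suc m) (toℕ k) x (toℕ≤pred[n] k) hx)
      ≈ summand ρ ι*ρ y m e f u inv-e inv-f (toℕ k) * ∑< (toℕ k) (λ i → u i ^ 3)
term-summand m x y n≥1 hx hy e f u inv-e inv-f inv-u k =
  *-cong (*-cong (*-cong (signed-binom (fromℕ (suc m)) (toℕ k)) quotient) fraction)
    (H-power-sum 3 (toℕ k) (suc m) x (toℕ≤pred[n] k) hx u inv-u)
  where
  open CommutativeRing ℂ-ring using (trans; sym; *-cong; *-congʳ)
  quotient : binom (y + fromℕ (toℕ k)) (toℕ k)
             / (binom (y - fromℕ (suc m) + fromℕ (toℕ k)) (toℕ k)
               , binom[y-n+k]#0 (suc m) y (toℕ k) hy (toℕ≤pred[n] k))
             ≈ rising ρ ι*ρ y (toℕ k) * e (toℕ k)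
  quotient = trans
    (/-inverse (binom[y-n+k]#0 (suc m) y (toℕ k) hy (toℕ≤pred[n] k))
      (trans (*-congʳ (binom-rising (y - fromℕ (suc m)) (toℕ k))) (inv-e (toℕ k) (toℕ≤pred[n] k))))
    (*-congʳ (binom-rising y (toℕ k)))
  fraction : y / (y + fromℕ (toℕ k) , y+k#0 (suc m) y (toℕ k) n≥1 hy (toℕ≤pred[n] k)) ≈ y * f (toℕ k)
  fraction = /-inverse (y+k#0 (suc m) y (toℕ k) n≥1 hy (toℕ≤pred[n] k)) (inv-f (toℕ k) (toℕ≤pred[n] k))

identity-from-terms : ∀ m x y (n≥1 : 1 ℕ.≤ suc m)
    (hx  : x ∉[ ℤ.- (ℤ.+ suc m) , -1ℤ ])
    (hxy : x - y ∉[ ℤ.- (ℤ.+ suc m) , -1ℤ ])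
    (hy  : y ∉[ ℤ.- (ℤ.+ suc m) , ℤ.+ suc m ℤ.- 1ℤ ])
    (e f u v : ℕ → ℂ)
    (inv-e : ∀ k → k ℕ.≤ suc m → rising ρ ι*ρ (y - fromℕ (suc m)) k * e k ≈ 1#)
    (inv-f : ∀ k → k ℕ.≤ suc m → (y + fromℕ k) * f k ≈ 1#) →
    Inverts (suc m) x u → Inverts (suc m) (x - y) v → (t : Fin (suc (suc m)) → ℂ) →
    (∀ k → t k ≈ summand ρ ι*ρ y m e f u inv-e inv-f (toℕ k) * ∑< (toℕ k) (λ i → u i ^ 3)) →
    ∑[ k ≤ suc m ] t k
    ≈ ((- 1#) ^ suc m / (fromℕ (2 ℕ.* suc m) , 2n#0 (suc m) n≥1))
      * (binom (x - y + fromℕ (suc m)) (suc m)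
         / (binom (x + fromℕ (suc m)) (suc m) * binom y (suc m) , binom[x+n]*binom[y]#0 (suc m) x y hx hy))
      * ((H 2 (suc m) (x - y) hxy - H 2 (suc m) x hx)
         - (H 1 (suc m) (x - y) hxy - H 1 (suc m) x hx) ^ 2)
identity-from-terms m x y n≥1 hx hxy hy e f u v inv-e inv-f inv-u inv-v t t≈ =
  trans (sum-cong-≋ {_} {t} {λ k → summand ρ ι*ρ y m e f u inv-e inv-f (toℕ k) * ∑< (toℕ k) λ i → u i ^ 3} t≈)
  (trans (transformation ρ ι*ρ x y m e f u v inv-e inv-f inv-u inv-v denominator doubled)
    (sym (*-cong (*-congˡ (*-congʳ (binom-rising (x - y) (suc m))))
      (+-cong (H-gap 2 (suc m) x y hx hxy u v inv-u inv-v)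
        (-‿cong (^-congˡ 2 (H-gap 1 (suc m) x y hx hxy u v inv-u inv-v)))))))
  where
  open CommutativeRing ℂ-ring using (trans; sym; *-cong; *-congˡ; *-congʳ; +-cong; -‿cong; +-commutativeMonoid; semiring)
  open import Algebra.Properties.Semiring.Exp semiring using (^-congˡ)
  open FoldsBelow +-commutativeMonoid using (sum-cong-≋)
  open IntegerCoefficients ℂ-ring using (solve; _:+_; _:-_; _:=_)

  doubled : (fromℕ (suc m) + fromℕ (suc m)) * inverse (2n#0 (suc m) n≥1) ≈ 1#
  doubled = trans (*-congʳ (sym (ι-+ (suc m) (suc m) (≡.cong (suc m ℕ.+_) (ℕ.+-identityʳ (suc m))))))
    (*-inverse (2n#0 (suc m) n≥1))

  -- As y - n + n = y for n = m + 1, the second factor is `binom y (suc m)`.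
  denominator : rising ρ ι*ρ x (suc m) * rising ρ ι*ρ (y - fromℕ (suc m)) (suc m)
                * inverse (binom[x+n]*binom[y]#0 (suc m) x y hx hy) ≈ 1#
  denominator = trans
    (*-congʳ (*-cong (sym (binom-rising x (suc m)))
      (trans (sym (binom-rising (y - fromℕ (suc m)) (suc m))) (binom-cong (suc m)
        (solve 2 (λ y N → y :- N :+ N := y) (CommutativeRing.refl ℂ-ring) y (fromℕ (suc m)))))))
    (*-inverse (binom[x+n]*binom[y]#0 (suc m) x y hx hy))

theorem10 :
  (n : ℕ) (x y : ℂ)
  (n≥1 : 1 ℕ.≤ n)
  (hx  : x ∉[ ℤ.- (ℤ.+ n) , -1ℤ ])
  (hxy : x - y ∉[ ℤ.- (ℤ.+ n) , -1ℤ ])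
  (hy  : y ∉[ ℤ.- (ℤ.+ n) , ℤ.+ n ℤ.- 1ℤ ]) →
  ∑[ k ≤ n ]
    ((- 1#) ^ toℕ k * binom (fromℕ n) (toℕ k)
      * (binom (y + fromℕ (toℕ k)) (toℕ k)
         / (binom (y - fromℕ n + fromℕ (toℕ k)) (toℕ k)
           , binom[y-n+k]#0 n y (toℕ k) hy (toℕ≤pred[n] k)))
      * (y / (y + fromℕ (toℕ k) , y+k#0 n y (toℕ k) n≥1 hy (toℕ≤pred[n] k)))
      * H 3 (toℕ k) x (restrict n (toℕ k) x (toℕ≤pred[n] k) hx))
  ≈ ((- 1#) ^ n / (fromℕ (2 ℕ.* n) , 2n#0 n n≥1))
    * (binom (x - y + fromℕ n) n
       / (binom (x + fromℕ n) n * binom y n , binom[x+n]*binom[y]#0 n x y hx hy))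
    * ((H 2 n (x - y) hxy - H 2 n x hx)
       - (H 1 n (x - y) hxy - H 1 n x hx) ^ 2)
theorem10 n@(suc m) x y n≥1 hx hxy hy =
  identity-from-terms m x y n≥1 hx hxy hy (proj₁ e) (proj₁ f) (proj₁ u) (proj₁ v) inv-e inv-f (proj₂ u) (proj₂ v) _
    (term-summand m x y n≥1 hx hy (proj₁ e) (proj₁ f) (proj₁ u) inv-e inv-f (proj₂ u))
  where
  open CommutativeRing ℂ-ring using (trans; sym; *-congʳ)
  u = inverses n (λ i → x + fromℕ (suc i)) (shift#0 n x hx)
  v = inverses n (λ i → x - y + fromℕ (suc i)) (shift#0 n (x - y) hxy)
  -- The index k runs from 0 to n inclusive, hence the range `suc n`.
  e = inverses (suc n) (λ k → binom (y - fromℕ n + fromℕ k) k)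
    λ { k (s≤s k≤n) → binom[y-n+k]#0 n y k hy k≤n }
  f = inverses (suc n) (λ k → y + fromℕ k) λ { k (s≤s k≤n) → y+k#0 n y k n≥1 hy k≤n }
  inv-e : ∀ k → k ℕ.≤ n → rising ρ ι*ρ (y - fromℕ n) k * proj₁ e k ≈ 1#
  inv-e k k≤n = trans (*-congʳ (sym (binom-rising (y - fromℕ n) k))) (proj₂ e k (s≤s k≤n))
  inv-f : ∀ k → k ℕ.≤ n → (y + fromℕ k) * proj₁ f k ≈ 1#
  inv-f k k≤n = proj₂ f k (s≤s k≤n)
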